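{- Let $q=3^d$ with $d\geq 1$, let $b\in\mathbb{F}_q$, and consider the elliptic curve $E\colon y^2=x^3-x+b$ over $\mathbb{F}_q$. For $d$ odd, \[\#E(\mathbb{F}_q)=\begin{cases} q+1 & \text{if } \operatorname{Tr}(b)=0,\\ q+1+(-1)^{\frac{d-1}{2}}\sqrt{3q} & \text{if } \operatorname{Tr}(b)=1,\\ q+1-(-1)^{\frac{d-1}{2}}\sqrt{3q} & \text{if } \operatorname{Tr}(b)=-1. \end{cases}\] For $d$ even, \[\#E(\mathbb{F}_q)=\begin{cases} q+1-(-1)^{\frac d2}\,2\sqrt q & \text{if } \operatorname{Tr}(b)=0,\\ q+1+(-1)^{\frac d2}\sqrt q & \text{if } \operatorname{Tr}(b)=\pm1. \end{cases}\]
   Context: $\operatorname{Tr}$ denotes the trace map $\mathbb{F}_q\to\mathbb{F}_3$, with $\mathbb{F}_3=\{0,1,-1\}$. $\#E(\mathbb{F}_q)$ counts all $\mathbb{F}_q$-rational points, including the point at infinity. -}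

module Defs where

open import Level using (Level; _⊔_)
open import Algebra.Apartness.Bundles using (HeytingCommutativeRing; HeytingField)
open import Algebra.Bundles using (CommutativeRing)
import Algebra.Properties.Semiring.Exp as Exp
import Algebra.Properties.Semiring.Sum as Sum
open import Data.Fin using (Fin; toℕ)
open import Data.Maybe.Relation.Binary.Pointwise as Maybe using ()
open import Data.Nat as ℕ using (ℕ; zero; suc; _≤_; _<_; _≤?_; s≤s; z≤n)
open import Data.Nat.Divisibility using (_∣_; _∤_; divides; m%n≡0⇒n∣m)
open import Data.Nat.DivMod using (_%_; _/_; m≡m%n+[m/n]*n; m%n<n)
import Data.Nat.Properties as ℕₚ
open import Data.Product using (Σ; _×_; _,_; proj₁; proj₂)
open import Data.Product.Relation.Binary.Pointwise.NonDependent using (_×ₛ_)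
open import Function.Bundles using (Inverse)
open import Relation.Binary.Bundles using (Setoid)
import Relation.Binary.Construct.On as On
open import Relation.Binary.PropositionalEquality as ≡ using (_≡_)
open import Relation.Nullary using (yes; no; contradiction)

_HasCardinality_ : ∀ {a ℓ} → Setoid a ℓ → ℕ → Set (a ⊔ ℓ)
S HasCardinality n = Inverse S (≡.setoid (Fin n))

-- The integer part of the square root.  It is only applied to perfect
-- squares, see ⌊√q⌋² and ⌊√3q⌋² below.
⌊√_⌋ : ℕ → ℕ
⌊√ zero ⌋ = zero
⌊√ suc n ⌋ with suc ⌊√ n ⌋ ℕ.* suc ⌊√ n ⌋ ≤? suc n
... | yes _ = suc ⌊√ n ⌋
... | no  _ = ⌊√ n ⌋

⌊√⌋-lower : ∀ n → ⌊√ n ⌋ ℕ.* ⌊√ n ⌋ ≤ n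
⌊√⌋-lower zero = z≤n
⌊√⌋-lower (suc n) with suc ⌊√ n ⌋ ℕ.* suc ⌊√ n ⌋ ≤? suc n
... | yes r²≤n = r²≤n
... | no  _    = ℕₚ.m≤n⇒m≤1+n (⌊√⌋-lower n)

⌊√⌋-upper : ∀ n → n < suc ⌊√ n ⌋ ℕ.* suc ⌊√ n ⌋
⌊√⌋-upper zero = s≤s z≤n
⌊√⌋-upper (suc n) with suc ⌊√ n ⌋ ℕ.* suc ⌊√ n ⌋ ≤? suc n
... | yes _    = ℕₚ.≤-<-trans (⌊√⌋-upper n)
                   (ℕₚ.*-mono-< (ℕₚ.n<1+n (suc ⌊√ n ⌋)) (ℕₚ.n<1+n (suc ⌊√ n ⌋)))
... | no  r²≰n = ℕₚ.≰⇒> r²≰n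

⌊√m²⌋ : ∀ m → ⌊√ m ℕ.* m ⌋ ≡ m
⌊√m²⌋ m = ℕₚ.≤-antisym
  (ℕₚ.≮⇒≥ λ m<r → ℕₚ.<⇒≱ (ℕₚ.*-mono-< m<r m<r) (⌊√⌋-lower (m ℕ.* m)))
  (ℕₚ.≮⇒≥ λ r<m → ℕₚ.<⇒≱ (⌊√⌋-upper (m ℕ.* m)) (ℕₚ.*-mono-≤ r<m r<m))

square⇒⌊√⌋² : ∀ {n} m → n ≡ m ℕ.* m → ⌊√ n ⌋ ℕ.* ⌊√ n ⌋ ≡ n
square⇒⌊√⌋² m ≡.refl = ≡.cong₂ ℕ._*_ (⌊√m²⌋ m) (⌊√m²⌋ m)

3^2k-square : ∀ k → 3 ℕ.^ (k ℕ.* 2) ≡ 3 ℕ.^ k ℕ.* 3 ℕ.^ k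
3^2k-square k = ≡.trans
  (≡.cong (3 ℕ.^_) (≡.trans (ℕₚ.*-comm k 2) (≡.cong (k ℕ.+_) (ℕₚ.+-identityʳ k))))
  (ℕₚ.^-distribˡ-+-* 3 k k)

⌊√q⌋² : ∀ d → 2 ∣ d → ⌊√ 3 ℕ.^ d ⌋ ℕ.* ⌊√ 3 ℕ.^ d ⌋ ≡ 3 ℕ.^ d
⌊√q⌋² _ (divides k ≡.refl) = square⇒⌊√⌋² (3 ℕ.^ k) (3^2k-square k)

2∤⇒%2≡1 : ∀ d → 2 ∤ d → d % 2 ≡ 1
2∤⇒%2≡1 d 2∤d with d % 2 in eq | m%n<n d 2
... | 0 | _ = contradiction (m%n≡0⇒n∣m d 2 eq) 2∤d
... | 1 | _ = ≡.refl
... | suc (suc _) | s≤s (s≤s ())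

⌊√3q⌋² : ∀ d → 2 ∤ d →
         ⌊√ 3 ℕ.* 3 ℕ.^ d ⌋ ℕ.* ⌊√ 3 ℕ.* 3 ℕ.^ d ⌋ ≡ 3 ℕ.* 3 ℕ.^ d
⌊√3q⌋² d 2∤d = square⇒⌊√⌋² (3 ℕ.^ suc (d / 2)) (≡.trans
  (≡.cong (λ e → 3 ℕ.^ suc e)
    (≡.trans (m≡m%n+[m/n]*n d 2) (≡.cong (ℕ._+ d / 2 ℕ.* 2) (2∤⇒%2≡1 d 2∤d))))
  (3^2k-square (suc (d / 2))))

-- A finite setoid has decidable equality, so a HeytingField of finite
-- cardinality is a finite field in the usual sense: there x # y is
-- equivalent to ¬ (x ≈ y), and every nonzero element is invertible.
module _ {c ℓ₁ ℓ₂ : Level} (F : HeytingField c ℓ₁ ℓ₂) where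
  open HeytingField F using (Carrier; _≈_; _+_; _-_; heytingCommutativeRing)
  open CommutativeRing (HeytingCommutativeRing.commutativeRing heytingCommutativeRing)
    using (setoid; semiring)
  open Exp semiring using (_^_)
  open Sum semiring using (sum)

  -- The sum of the conjugates b, b³, …, b^(3^(d-1)).  If F has 3^d elements,
  -- this is the trace of F over its prime field 𝔽₃ = {0#, 1#, - 1#} ⊆ F.
  Tr : ℕ → Carrier → Carrier
  Tr d b = sum λ (i : Fin d) → b ^ (3 ℕ.^ toℕ i)

  AffinePoint : Carrier → Set (c ⊔ ℓ₁)
  AffinePoint b = Σ (Carrier × Carrier) λ (x , y) → y ^ 2 ≈ x ^ 3 - x + b

  -- The F-rational points of y² = x³ - x + b, compared by their coordinates.
  -- Maybe adjoins the point at infinity, as nothing.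
  E : Carrier → Setoid (c ⊔ ℓ₁) (c ⊔ ℓ₁)
  E b = Maybe.setoid (On.setoid {B = AffinePoint b} (setoid ×ₛ setoid) proj₁)

{-# OPTIONS --safe #-}
module Submission where

-- Since Tr(x³ - x) = 0 and the fibres of x ↦ x³ - x over the kernel of the trace have three
-- elements, #E = 1 + 3 N(Tr b) with N(c) = #{y : Tr(y²) = c}.  Put Q = 3^(d-1) and
-- a = N(1) - Q, b = N(-1) - Q.  Counting the solutions of Tr(y²) = Tr(z²) through the
-- factorisation y² - z² = (y - z)(y + z) gives a² + ab + b² = Q.  This Eisenstein norm
-- equation determines (a, b) up to a common sign once a and b are known to be odd, and the
-- sign is read off from a modulo 4.  The residue is found as follows: N(1) = 2S, where S is
-- the number of nonzero squares of trace 1.  The product of all elements of trace 1 is 1, as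
-- one sees by evaluating Tr(X) + 1 = ∏ (X - u), with Tr u = -1, at X = 0; so the number of
-- nonsquares of trace 1 is even, and S is odd because there are Q elements of trace 1.

open import Defs
open import Level using (Level; _⊔_)
open import Algebra.Apartness.Bundles using (HeytingCommutativeRing; HeytingField)
open import Algebra.Bundles using (CommutativeMonoid; CommutativeRing)
import Algebra.Properties.CommutativeMonoid.Sum as MonoidSum
import Algebra.Properties.CommutativeSemiring.Exp as Exp
import Algebra.Properties.Ring as RingProperties
import Algebra.Properties.Semiring.Mult as Mult
import Algebra.Properties.Semiring.Sum as SemiringSum
import Algebra.Solver.Ring.NaturalCoefficients.Default as RingSolver
open import Data.Bool.Base using (if_then_else_)
open import Data.Empty using (⊥-elim)
open import Data.Fin.Base as Fin using (Fin; zero; suc; toℕ)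
open import Data.Fin.Permutation using (permutation)
import Data.Fin.Properties as Finₚ
import Data.Integer.Divisibility.Signed as ℤ∣
import Data.Integer.Properties as ℤₚ
open import Data.Integer.Tactic.RingSolver using (solve-∀)
open import Data.Maybe.Base using (Maybe; just; nothing)
import Data.Maybe.Relation.Binary.Pointwise as Maybe
open import Data.Nat as ℕ using (ℕ; zero; suc; _≤_; _<_; _≥_; _∸_; _/_; z≤n; s≤s)
open import Data.Nat.Divisibility using (_∣_; _∤_; divides)
open import Data.Nat.DivMod using (m*n/n≡m; m≡m%n+[m/n]*n)
open import Data.Nat.Primality using (euclidsLemma; prime?)
import Data.Nat.Properties as ℕₚ
open import Data.Nat.Solver using (module +-*-Solver)
open import Data.Product using (Σ; ∃-syntax; _×_; _,_; proj₁; proj₂)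
open import Data.Product.Relation.Binary.Pointwise.NonDependent using (_×ₛ_)
open import Data.Sum using (_⊎_; inj₁; inj₂; [_,_]′)
open import Function.Base using (_∘_; id)
open import Function.Bundles using (Inverse)
open import Relation.Binary.Bundles using (Setoid)
import Relation.Binary.Construct.On as On
open import Relation.Binary.PropositionalEquality as ≡
  using (_≡_; _≢_; cong; cong₂; subst; module ≡-Reasoning)
import Relation.Binary.Reasoning.Setoid as SetoidReasoning
open import Relation.Nullary using (Dec; yes; no; ¬_; does; contradiction)
open import Relation.Nullary.Decidable using (from-yes)

-- Exact fibre sizes come from upper bounds. A polynomial function with nonzero leading coefficient
-- has at most as many roots as its degree, and when the resulting bounds on the fibres of the
-- trace, of x³ - x and of squaring add up to q, every one of them is attained; no preimage is ever
-- constructed. The norm form a² + ab + b² has symmetries beyond the sign: a solution has six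
-- associates under the units of the Eisenstein integers, and their conjugates. When the norm is
-- odd, exactly one of a, b and a + b is even, so asking a and b to be odd leaves only the exchange
-- of the two and the common sign, and the solutions are multiples of (1, -1) or (1, 1). The sign is
-- the delicate point, as for a Gauss sum: counting pairs gives quadratic information only, and N(1)
-- modulo 4 supplies the rest.

module ℕΣ = SemiringSum ℕₚ.+-*-semiring
module ℕSolver = +-*-Solver

private
  variable
    ℓᵖ ℓʳ : Level
    P : Set ℓᵖ
    R R′ : Set ℓʳ
    n : ℕ

-- Indicators and finite sums of natural numbers

⟦_⟧ : Dec P → ℕ
⟦ p ⟧ = if does p then 1 else 0

⟦yes⟧ : (p? : Dec P) → P → ⟦ p? ⟧ ≡ 1
⟦yes⟧ (yes _) _ = ≡.refl
⟦yes⟧ (no ¬p) p = contradiction p ¬p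

⟦no⟧ : (p? : Dec P) → ¬ P → ⟦ p? ⟧ ≡ 0
⟦no⟧ (yes p) ¬p = contradiction p ¬p
⟦no⟧ (no _)  _  = ≡.refl

⟦⟧-mono : (p? : Dec P) (r? : Dec R) → (P → R) → ⟦ p? ⟧ ≤ ⟦ r? ⟧
⟦⟧-mono (no _)  _  _   = z≤n
⟦⟧-mono (yes p) r? p→r = ℕₚ.≤-reflexive (≡.sym (⟦yes⟧ r? (p→r p)))

⟦⟧-cong : (p? : Dec P) (r? : Dec R) → (P → R) → (R → P) → ⟦ p? ⟧ ≡ ⟦ r? ⟧
⟦⟧-cong p? r? to from = ℕₚ.≤-antisym (⟦⟧-mono p? r? to) (⟦⟧-mono r? p? from)

⟦⟧-⊎ : (p? : Dec P) (r? : Dec R) (s? : Dec R′) → (P → R ⊎ R′) → ⟦ p? ⟧ ≤ ⟦ r? ⟧ ℕ.+ ⟦ s? ⟧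
⟦⟧-⊎ (no _)  r? s? f = z≤n
⟦⟧-⊎ (yes p) r? s? f with f p
... | inj₁ r = ℕₚ.≤-trans (ℕₚ.≤-reflexive (≡.sym (⟦yes⟧ r? r))) (ℕₚ.m≤m+n _ _)
... | inj₂ s = ℕₚ.≤-trans (ℕₚ.≤-reflexive (≡.sym (⟦yes⟧ s? s))) (ℕₚ.m≤n+m _ _)

⟦⟧-split : (p? : Dec P) (r? : Dec R) (s? : Dec R′) → (R′ → P ⊎ R) → (P → ¬ R) →
           ⟦ p? ⟧ ℕ.* ⟦ s? ⟧ ℕ.+ ⟦ r? ⟧ ℕ.* ⟦ s? ⟧ ≡ ⟦ s? ⟧
⟦⟧-split p?      r?      (no _)  _     _    = cong₂ ℕ._+_ (ℕₚ.*-zeroʳ ⟦ p? ⟧) (ℕₚ.*-zeroʳ ⟦ r? ⟧)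
⟦⟧-split (yes p) (yes r) (yes _) _     p→¬r = contradiction r (p→¬r p)
⟦⟧-split (yes _) (no _)  (yes _) _     _    = ≡.refl
⟦⟧-split (no _)  (yes _) (yes _) _     _    = ≡.refl
⟦⟧-split (no ¬p) (no ¬r) (yes s) cover _    = ⊥-elim ([ ¬p , ¬r ]′ (cover s))

+-mono-≤-tight : ∀ {a b c d} → a ≤ c → b ≤ d → c ℕ.+ d ≤ a ℕ.+ b → a ≡ c × b ≡ d
+-mono-≤-tight {a} {b} {c} {d} a≤c b≤d c+d≤a+b =
  ℕₚ.≤-antisym a≤c (ℕₚ.+-cancelʳ-≤ d c a (ℕₚ.≤-trans c+d≤a+b (ℕₚ.+-monoʳ-≤ a b≤d))) ,
  ℕₚ.≤-antisym b≤d (ℕₚ.+-cancelˡ-≤ c d b (ℕₚ.≤-trans c+d≤a+b (ℕₚ.+-monoˡ-≤ b a≤c)))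

all-tight : ∀ {a b c m} → a ≤ m → b ≤ m → c ≤ m → a ℕ.+ b ℕ.+ c ≡ 3 ℕ.* m → a ≡ m × b ≡ m × c ≡ m
all-tight {m = m} a≤m b≤m c≤m eq
  with +-mono-≤-tight (ℕₚ.+-mono-≤ a≤m b≤m) c≤m (ℕₚ.≤-reflexive (≡.trans
         (≡.trans (ℕₚ.+-assoc m m m) (cong (λ k → m ℕ.+ (m ℕ.+ k)) (≡.sym (ℕₚ.+-identityʳ m)))) (≡.sym eq)))
... | eq₂ , eq₃ with +-mono-≤-tight a≤m b≤m (ℕₚ.≤-reflexive (≡.sym eq₂))
... | eq₀ , eq₁ = eq₀ , eq₁ , eq₃

sum-mono-≤ : {f g : Fin n → ℕ} → (∀ i → f i ≤ g i) → ℕΣ.sum f ≤ ℕΣ.sum g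
sum-mono-≤ {n = zero}  f≤g = z≤n
sum-mono-≤ {n = suc n} f≤g = ℕₚ.+-mono-≤ (f≤g zero) (sum-mono-≤ (f≤g ∘ suc))

-- This is what turns bounds into exact counts: once the totals agree, no single inequality has room
-- to be strict.
sum-mono-≤-tight : {f g : Fin n → ℕ} → (∀ i → f i ≤ g i) →
                   ℕΣ.sum g ≤ ℕΣ.sum f → ∀ i → f i ≡ g i
sum-mono-≤-tight {n = suc n} f≤g ∑g≤∑f i
  with +-mono-≤-tight (f≤g zero) (sum-mono-≤ (f≤g ∘ suc)) ∑g≤∑f
sum-mono-≤-tight f≤g ∑g≤∑f zero    | eq , _   = eq
sum-mono-≤-tight f≤g ∑g≤∑f (suc i) | _  , eqs =
  sum-mono-≤-tight (f≤g ∘ suc) (ℕₚ.≤-reflexive (≡.sym eqs)) i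

sum-const : ∀ n k → ℕΣ.sum {n} (λ _ → k) ≡ n ℕ.* k
sum-const zero    k = ≡.refl
sum-const (suc n) k = cong (k ℕ.+_) (sum-const n k)

3^-odd : ∀ n → ∃[ g ] 3 ℕ.^ n ≡ suc (2 ℕ.* g)
3^-odd zero    = 0 , ≡.refl
3^-odd (suc n) with 3^-odd n
... | g , eq = suc (3 ℕ.* g) , ≡.trans (cong (3 ℕ.*_) eq)
  (ℕSolver.solve 1 (λ g → con 3 :* (con 1 :+ con 2 :* g) := con 1 :+ con 2 :* (con 1 :+ con 3 :* g)) ≡.refl g)
  where open ℕSolver using (con; _:*_; _:+_; _:=_)

odd-summand : ∀ s m g → s ℕ.+ 2 ℕ.* m ≡ suc (2 ℕ.* g) → ∃[ t ] s ≡ suc (2 ℕ.* t)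
odd-summand 0 m g eq = contradiction eq (ℕₚ.even≢odd m g)
odd-summand 1 m g eq = 0 , ≡.refl
odd-summand (suc (suc s)) m g eq
  with odd-summand s (suc m) g (≡.trans
    (ℕSolver.solve 2 (λ s m → s :+ con 2 :* (con 1 :+ m) := con 2 :+ s :+ con 2 :* m) ≡.refl s m) eq)
  where open ℕSolver using (con; _:*_; _:+_; _:=_)
... | t , ≡.refl = suc t , cong (λ k → suc (suc k)) (≡.sym (ℕₚ.+-suc t (t ℕ.+ 0)))

sum-++ : ∀ m {n} (f : Fin (m ℕ.+ n) → ℕ) →
         ℕΣ.sum f ≡ ℕΣ.sum (λ i → f (i Fin.↑ˡ n)) ℕ.+ ℕΣ.sum (λ j → f (m Fin.↑ʳ j))
sum-++ zero    f = ≡.refl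
sum-++ (suc m) f = ≡.trans (cong (f zero ℕ.+_) (sum-++ m (f ∘ suc))) (≡.sym (ℕₚ.+-assoc (f zero) _ _))

sum-combine : ∀ m {n} (f : Fin (m ℕ.* n) → ℕ) →
              ℕΣ.sum f ≡ ℕΣ.sum (λ (i : Fin m) → ℕΣ.sum (λ (j : Fin n) → f (Fin.combine i j)))
sum-combine zero        f = ≡.refl
sum-combine (suc m) {n} f = ≡.trans (sum-++ n f)
  (cong (ℕΣ.sum (λ j → f (j Fin.↑ˡ (m ℕ.* n))) ℕ.+_) (sum-combine m (λ k → f (n Fin.↑ʳ k))))

-- Cardinalities of decidable subsets, products and `Maybe`

module _ {n m : ℕ} {ℓᵖ : Level} {B : Fin (suc n) → Set ℓᵖ} where
  -- The decision for `zero` is an explicit argument, so that matching on it also reduces the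
  -- `⟦ zero? ⟧` in the size of the target.
  rank-suc : (zero? : Dec (B zero)) → (∀ i → B (suc i) → Fin m) → ∀ i → B i → Fin (⟦ zero? ⟧ ℕ.+ m)
  rank-suc (yes _) r zero    _ = zero
  rank-suc (no ¬b) r zero    b = contradiction b ¬b
  rank-suc (yes _) r (suc i) b = suc (r i b)
  rank-suc (no _)  r (suc i) b = r i b

  unrank-suc : (zero? : Dec (B zero)) → (Fin m → Σ (Fin n) (B ∘ suc)) →
               Fin (⟦ zero? ⟧ ℕ.+ m) → Σ (Fin (suc n)) B
  unrank-suc (yes b) u zero    = zero , b
  unrank-suc (yes _) u (suc k) = suc (proj₁ (u k)) , proj₂ (u k)
  unrank-suc (no _)  u k       = suc (proj₁ (u k)) , proj₂ (u k)

  module _ {r : ∀ i → B (suc i) → Fin m} {u : Fin m → Σ (Fin n) (B ∘ suc)} where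
    unrank-suc∘rank-suc : (zero? : Dec (B zero)) → (∀ i b → proj₁ (u (r i b)) ≡ i) →
                          ∀ i b → proj₁ (unrank-suc zero? u (rank-suc zero? r i b)) ≡ i
    unrank-suc∘rank-suc (yes _) ur zero    _ = ≡.refl
    unrank-suc∘rank-suc (no ¬b) ur zero    b = contradiction b ¬b
    unrank-suc∘rank-suc (yes _) ur (suc i) b = cong suc (ur i b)
    unrank-suc∘rank-suc (no _)  ur (suc i) b = cong suc (ur i b)

    rank-suc∘unrank-suc : (zero? : Dec (B zero)) → (∀ k → r (proj₁ (u k)) (proj₂ (u k)) ≡ k) →
                          ∀ k → rank-suc zero? r (proj₁ (unrank-suc zero? u k)) (proj₂ (unrank-suc zero? u k)) ≡ k
    rank-suc∘unrank-suc (yes _) ru zero    = ≡.refl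
    rank-suc∘unrank-suc (yes _) ru (suc k) = cong suc (ru k)
    rank-suc∘unrank-suc (no _)  ru k       = ru k

    rank-suc-irrelevant : (zero? : Dec (B zero)) → (∀ i b b′ → r i b ≡ r i b′) →
                          ∀ i b b′ → rank-suc zero? r i b ≡ rank-suc zero? r i b′
    rank-suc-irrelevant (yes _) rr zero    _ _  = ≡.refl
    rank-suc-irrelevant (no ¬b) rr zero    b _  = contradiction b ¬b
    rank-suc-irrelevant (yes _) rr (suc i) b b′ = cong suc (rr i b b′)
    rank-suc-irrelevant (no _)  rr (suc i) b b′ = rr i b b′

rank : {B : Fin n → Set ℓᵖ} (B? : ∀ i → Dec (B i)) → ∀ i → B i → Fin (ℕΣ.sum (λ i → ⟦ B? i ⟧))
rank {n = suc n} B? = rank-suc (B? zero) (rank (B? ∘ suc))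

unrank : {B : Fin n → Set ℓᵖ} (B? : ∀ i → Dec (B i)) → Fin (ℕΣ.sum (λ i → ⟦ B? i ⟧)) → Σ (Fin n) B
unrank {n = suc n} B? = unrank-suc (B? zero) (unrank (B? ∘ suc))

unrank∘rank : {B : Fin n → Set ℓᵖ} (B? : ∀ i → Dec (B i)) → ∀ i b → proj₁ (unrank B? (rank B? i b)) ≡ i
unrank∘rank {n = suc n} B? = unrank-suc∘rank-suc (B? zero) (unrank∘rank (B? ∘ suc))

rank∘unrank : {B : Fin n → Set ℓᵖ} (B? : ∀ i → Dec (B i)) →
              ∀ k → rank B? (proj₁ (unrank B? k)) (proj₂ (unrank B? k)) ≡ k
rank∘unrank {n = suc n} B? = rank-suc∘unrank-suc (B? zero) (rank∘unrank (B? ∘ suc))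

rank-irrelevant : {B : Fin n → Set ℓᵖ} (B? : ∀ i → Dec (B i)) → ∀ i b b′ → rank B? i b ≡ rank B? i b′
rank-irrelevant {n = suc n} B? =
  rank-suc-irrelevant {u = unrank (B? ∘ suc)} (B? zero) (rank-irrelevant (B? ∘ suc))

module _ {c ℓ} (X : Setoid c ℓ) {n} (X↔n : X HasCardinality n) where
  private module X = Setoid X
  open Inverse X↔n using (to; from; to-cong; from-cong; strictlyInverseˡ; strictlyInverseʳ)

  -- Elements of the subset are compared without their membership proofs; `rank-irrelevant` is what
  -- makes `to` respect this equality.
  subset-cardinality : ∀ {p} {B : X.Carrier → Set p} (B? : ∀ x → Dec (B x)) →
    (∀ {x y} → x X.≈ y → B x → B y) →
    On.setoid X (proj₁ {B = B}) HasCardinality ℕΣ.sum (λ i → ⟦ B? (from i) ⟧)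
  subset-cardinality {B = B} B? B-resp = record
    { to        = λ (x , b) → rank B?′ (to x) (B-resp (X.sym (strictlyInverseʳ x)) b)
    ; from      = λ k → from (proj₁ (unrank B?′ k)) , proj₂ (unrank B?′ k)
    ; to-cong   = λ x≈y → rank-cong (to-cong x≈y)
    ; from-cong = λ { ≡.refl → X.refl }
    ; inverse   =
        (λ {k} x≈ → ≡.trans (rank-cong (≡.trans (to-cong x≈) (strictlyInverseˡ _))) (rank∘unrank B?′ k)) ,
        (λ {(x , b)} {k} k≡ → X.trans
          (from-cong (≡.trans (cong (proj₁ ∘ unrank B?′) k≡) (unrank∘rank B?′ (to x) _)))
          (strictlyInverseʳ x))
    }
    where
    B?′ : ∀ i → Dec (B (from i))
    B?′ = B? ∘ from
    rank-cong : ∀ {i j} {b : B (from i)} {b′ : B (from j)} → i ≡ j → rank B?′ i b ≡ rank B?′ j b′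
    rank-cong ≡.refl = rank-irrelevant B?′ _ _ _

  product-cardinality : ∀ {c′ ℓ′} (Y : Setoid c′ ℓ′) {m} → Y HasCardinality m →
                        (X ×ₛ Y) HasCardinality (n ℕ.* m)
  product-cardinality Y {m} Y↔m = record
    { to        = λ (x , y) → Fin.combine (to x) (Y↔.to y)
    ; from      = λ k → from (proj₁ (Fin.remQuot {n} m k)) , Y↔.from (proj₂ (Fin.remQuot {n} m k))
    ; to-cong   = λ (x≈ , y≈) → cong₂ Fin.combine (to-cong x≈) (Y↔.to-cong y≈)
    ; from-cong = λ { ≡.refl → X.refl , Setoid.refl Y }
    ; inverse   =
        (λ {k} (x≈ , y≈) → ≡.trans
          (cong₂ Fin.combine (≡.trans (to-cong x≈) (strictlyInverseˡ _))
                             (≡.trans (Y↔.to-cong y≈) (Y↔.strictlyInverseˡ _)))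
          (Finₚ.combine-remQuot {n} m k)) ,
        (λ {(x , y)} {k} k≡ →
          let eq = ≡.trans (cong (Fin.remQuot {n} m) k≡) (Finₚ.remQuot-combine (to x) (Y↔.to y)) in
          X.trans (from-cong (cong proj₁ eq)) (strictlyInverseʳ x) ,
          Setoid.trans Y (Y↔.from-cong (cong proj₂ eq)) (Y↔.strictlyInverseʳ y))
    }
    where module Y↔ = Inverse Y↔m

  maybe-cardinality : Maybe.setoid X HasCardinality suc n
  maybe-cardinality = record
    { to        = to′
    ; from      = from′
    ; to-cong   = to′-cong
    ; from-cong = λ { ≡.refl → Setoid.refl (Maybe.setoid X) }
    ; inverse   =
        (λ {k} x≈ → ≡.trans (to′-cong x≈) (to′-from′ k)) ,
        (λ {x} k≡ → Setoid.trans (Maybe.setoid X)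
          (Setoid.reflexive (Maybe.setoid X) (cong from′ k≡)) (from′-to′ x))
    }
    where
    to′ : Maybe X.Carrier → Fin (suc n)
    to′ nothing  = zero
    to′ (just x) = suc (to x)
    from′ : Fin (suc n) → Maybe X.Carrier
    from′ zero    = nothing
    from′ (suc k) = just (from k)
    to′-cong : ∀ {x y} → Setoid._≈_ (Maybe.setoid X) x y → to′ x ≡ to′ y
    to′-cong Maybe.nothing    = ≡.refl
    to′-cong (Maybe.just x≈y) = cong suc (to-cong x≈y)
    to′-from′ : ∀ k → to′ (from′ k) ≡ k
    to′-from′ zero    = ≡.refl
    to′-from′ (suc k) = cong suc (strictlyInverseˡ k)
    from′-to′ : ∀ x → Setoid._≈_ (Maybe.setoid X) (from′ (to′ x)) x
    from′-to′ nothing  = Maybe.nothing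
    from′-to′ (just x) = Maybe.just (strictlyInverseʳ x)

-- Finite sums over a setoid

module _ {m ℓ} (M : CommutativeMonoid m ℓ) where
  open CommutativeMonoid M
  open MonoidSum M

  sum-zero : (t : Fin n → Carrier) → (∀ i → t i ≈ ε) → sum t ≈ ε
  sum-zero {n = n} t t≈0 = trans (sum-cong-≋ {n} t≈0) (sum-replicate-zero n)

  sum-single : (t : Fin n → Carrier) (k : Fin n) → (∀ i → i ≢ k → t i ≈ ε) → sum t ≈ t k
  sum-single t zero t≈0 = trans
    (∙-congˡ (sum-zero (t ∘ suc) λ i → t≈0 (suc i) λ ()))
    (identityʳ (t zero))
  sum-single t (suc k) t≈0 = trans
    (∙-cong (t≈0 zero λ ())
      (sum-single (t ∘ suc) k λ i i≢k → t≈0 (suc i) (i≢k ∘ Finₚ.suc-injective)))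
    (identityˡ (t (suc k)))

-- An arbitrary commutative monoid serves three purposes below: counting in ℕ, sums in the field and
-- products in the field.
module FiniteSum {c ℓ} (X : Setoid c ℓ) {n} (X↔n : X HasCardinality n)
                 {m ℓm} (M : CommutativeMonoid m ℓm) where
  open Setoid X using () renaming (Carrier to C; _≈_ to _∼_)
  private module X = Setoid X
  open Inverse X↔n using (to; from; to-cong; from-cong; strictlyInverseˡ; strictlyInverseʳ)
  open CommutativeMonoid M
  open MonoidSum M

  ∑ : (C → Carrier) → Carrier
  ∑ f = sum (f ∘ from)

  ∑-cong : ∀ {f g} → (∀ x → f x ≈ g x) → ∑ f ≈ ∑ g
  ∑-cong f≈g = sum-cong-≋ {n} (f≈g ∘ from)

  -- Conjugating σ and τ by the enumeration gives a permutation of `Fin n`; the congruence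
  -- hypotheses absorb that `from (to x)` is only equivalent to x.
  ∑-bijection : ∀ {f} (σ τ : C → C) →
                (∀ {x y} → x ∼ y → f x ≈ f y) →
                (∀ {x y} → x ∼ y → σ x ∼ σ y) → (∀ {x y} → x ∼ y → τ x ∼ τ y) →
                (∀ x → σ (τ x) ∼ x) → (∀ x → τ (σ x) ∼ x) →
                ∑ f ≈ ∑ (f ∘ σ)
  ∑-bijection {f} σ τ f-cong σ-cong τ-cong στ τσ = trans
    (sum-permute (f ∘ from) (permutation (to ∘ σ ∘ from) (to ∘ τ ∘ from)
      (λ i → ≡.trans (to-cong (X.trans (σ-cong (strictlyInverseʳ _)) (στ _))) (strictlyInverseˡ i))
      (λ i → ≡.trans (to-cong (X.trans (τ-cong (strictlyInverseʳ _)) (τσ _))) (strictlyInverseˡ i))))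
    (sum-cong-≋ {n} λ i → f-cong (strictlyInverseʳ _))

  ∑-single : ∀ {f} a → (∀ {x y} → x ∼ y → f x ≈ f y) →
             (∀ x → ¬ x ∼ a → f x ≈ ε) → ∑ f ≈ f a
  ∑-single {f} a f-cong f≈0 = trans
    (sum-single M (f ∘ from) (to a) λ i i≢a →
      f≈0 (from i) λ i∼a → i≢a (≡.trans (≡.sym (strictlyInverseˡ i)) (to-cong i∼a)))
    (f-cong (strictlyInverseʳ a))

  ∑-∙ : ∀ f g → ∑ (λ x → f x ∙ g x) ≈ ∑ f ∙ ∑ g
  ∑-∙ f g = ∑-distrib-+ (f ∘ from) (g ∘ from)

-- The finite field: arithmetic, characteristic and x^q = x

module Field3^ {c ℓ₁ ℓ₂ : Level} (F : HeytingField c ℓ₁ ℓ₂) (e : ℕ)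
               (F↔q : HeytingField.setoid F HasCardinality (3 ℕ.^ suc e)) where

  open HeytingField F using (#⇒invertible; invertible⇒#; #-irrefl; tight)
  open CommutativeRing
    (HeytingCommutativeRing.commutativeRing (HeytingField.heytingCommutativeRing F))
    renaming (Carrier to K) hiding (zero)
  open Exp commutativeSemiring using
    (_^_; ^-congˡ; ^-congʳ; ^-homo-*; ^-assocʳ; ^-distrib-*)
  open RingProperties ring using
    (-0#≈0#; +-cancelˡ; -‿involutive; -‿injective; -‿+-comm; -1*x≈-x;
     +-inverseˡ-unique; +-identityʳ-unique)
  open Inverse F↔q using (to; from; to-cong; from-cong; strictlyInverseˡ; strictlyInverseʳ)
  open Mult semiring using (×1-homo-*) renaming (_×_ to _·_)
  open RingSolver commutativeSemiring using (solve; _:+_; _:*_; _:^_; con; _:=_)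
  module KΣ = SemiringSum semiring
  module KΠ = MonoidSum *-commutativeMonoid
  open SetoidReasoning setoid hiding (step-≡-⟩)

  -- Q turns out to be the common size of the three fibres of the trace, see `#T-all`.
  Q q : ℕ
  Q = 3 ℕ.^ e
  q = 3 ℕ.^ suc e

  module ℕ∑ = FiniteSum setoid F↔q ℕₚ.+-0-commutativeMonoid
  module K∏ = FiniteSum setoid F↔q *-commutativeMonoid
  module K∑ = FiniteSum setoid F↔q +-commutativeMonoid
  open ℕ∑ using (∑)
  open K∏ using () renaming (∑ to ∏)

  infix 4 _≟_
  _≟_ : ∀ x y → Dec (x ≈ y)
  x ≟ y with to x Finₚ.≟ to y
  ... | yes eq = yes (trans (sym (strictlyInverseʳ x)) (trans (from-cong eq) (strictlyInverseʳ y)))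
  ... | no neq = no (neq ∘ to-cong)

  0≉1 : ¬ 0# ≈ 1#
  0≉1 0≈1 = #-irrefl refl (invertible⇒# {0#} {0#}
    (0# , trans (zeroˡ _) 0≈1 , trans (zeroʳ _) 0≈1))

  x-y≈0⇒x≈y : ∀ {x y} → x - y ≈ 0# → x ≈ y
  x-y≈0⇒x≈y {x} {y} x-y≈0 = begin
    x            ≈⟨ +-identityʳ x ⟨
    x + 0#       ≈⟨ +-congˡ (-‿inverseˡ y) ⟨
    x + (- y + y) ≈⟨ +-assoc x (- y) y ⟨
    x - y + y    ≈⟨ +-congʳ x-y≈0 ⟩
    0# + y       ≈⟨ +-identityˡ y ⟩
    y            ∎

  x≈y⇒x-y≈0 : ∀ {x y} → x ≈ y → x - y ≈ 0#
  x≈y⇒x-y≈0 {y = y} x≈y = trans (+-congʳ x≈y) (-‿inverseʳ y)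

  x-y+y≈x : ∀ x y → x - y + y ≈ x
  x-y+y≈x x y = trans (+-assoc x (- y) y) (trans (+-congˡ (-‿inverseˡ y)) (+-identityʳ x))

  x+y-y≈x : ∀ x y → x + y - y ≈ x
  x+y-y≈x x y = trans (+-assoc x y (- y)) (trans (+-congˡ (-‿inverseʳ y)) (+-identityʳ x))

  -- From `¬ x ≈ 0#` one gets only that `x # 0#` cannot be refuted, so the field axiom does not hand
  -- over an inverse directly. A finite search decides whether there is one, and tightness rules out
  -- that it fails.
  inverse : ∀ x → ¬ x ≈ 0# → ∃[ y ] y * x ≈ 1#
  inverse x x≉0 with Finₚ.any? (λ i → from i * x ≟ 1#)
  ... | yes (i , eq) = from i , eq
  ... | no none = contradiction (proj₁ (tight x 0#) (λ x#0 → none (inv x#0))) x≉0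
    where
    inv : HeytingField._#_ F x 0# → ∃[ i ] from i * x ≈ 1#
    inv x#0 with #⇒invertible x#0
    ... | y , eq , _ = to y , (begin
      from (to y) * x  ≈⟨ *-cong (strictlyInverseʳ y) (sym (trans (+-congˡ -0#≈0#) (+-identityʳ x))) ⟩
      y * (x - 0#)     ≈⟨ eq ⟩
      1#               ∎)

  *-cancelˡ : ∀ x {y z} → ¬ x ≈ 0# → x * y ≈ x * z → y ≈ z
  *-cancelˡ x {y} {z} x≉0 xy≈xz with inverse x x≉0
  ... | w , wx≈1 = begin
    y            ≈⟨ *-identityˡ y ⟨
    1# * y       ≈⟨ *-congʳ wx≈1 ⟨
    w * x * y    ≈⟨ *-assoc w x y ⟩
    w * (x * y)  ≈⟨ *-congˡ xy≈xz ⟩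
    w * (x * z)  ≈⟨ *-assoc w x z ⟨
    w * x * z    ≈⟨ *-congʳ wx≈1 ⟩
    1# * z       ≈⟨ *-identityˡ z ⟩
    z            ∎

  xy≈0 : ∀ {x y} → x * y ≈ 0# → x ≈ 0# ⊎ y ≈ 0#
  xy≈0 {x} {y} xy≈0 with x ≟ 0#
  ... | yes x≈0 = inj₁ x≈0
  ... | no  x≉0 = inj₂ (*-cancelˡ x x≉0 (trans xy≈0 (sym (zeroʳ x))))

  prod≉0 : (f : Fin n → K) → (∀ i → ¬ f i ≈ 0#) → ¬ KΠ.sum f ≈ 0#
  prod≉0 {n = zero}  f f≉0 1≈0 = 0≉1 (sym 1≈0)
  prod≉0 {n = suc n} f f≉0 eq  = [ f≉0 zero , prod≉0 (f ∘ suc) (f≉0 ∘ suc) ]′ (xy≈0 eq)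

  x²≈1 : ∀ {x} → x * x ≈ 1# → x ≈ 1# ⊎ x ≈ - 1#
  x²≈1 {x} xx≈1 with xy≈0 {x - 1#} {x + 1#} (begin
      (x - 1#) * (x + 1#)                  ≈⟨ distribʳ (x + 1#) x (- 1#) ⟩
      x * (x + 1#) + - 1# * (x + 1#)       ≈⟨ +-cong (distribˡ x x 1#) (-1*x≈-x _) ⟩
      x * x + x * 1# - (x + 1#)            ≈⟨ +-congʳ (+-cong xx≈1 (*-identityʳ x)) ⟩
      1# + x - (x + 1#)                    ≈⟨ +-congʳ (+-comm 1# x) ⟩
      x + 1# - (x + 1#)                    ≈⟨ -‿inverseʳ (x + 1#) ⟩
      0#                                   ∎)
  ... | inj₁ x-1≈0 = inj₁ (x-y≈0⇒x≈y x-1≈0)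
  ... | inj₂ x+1≈0 = inj₂ (+-inverseˡ-unique x 1# x+1≈0)

  -- Translation by 1# permutes the summands of the sum of all elements.
  q·1≈0 : q · 1# ≈ 0#
  q·1≈0 = +-identityʳ-unique (K∑.∑ id) (q · 1#) (begin
    K∑.∑ id + q · 1#         ≈⟨ +-congˡ (KΣ.sum-replicate q) ⟨
    K∑.∑ id + K∑.∑ (λ _ → 1#) ≈⟨ K∑.∑-∙ id (λ _ → 1#) ⟨
    K∑.∑ (λ x → x + 1#)             ≈⟨ K∑.∑-bijection (_+ 1#) (_- 1#) id +-congʳ +-congʳ
                                        (λ x → x-y+y≈x x 1#) (λ x → x+y-y≈x x 1#) ⟨
    K∑.∑ id                  ∎)

  -- Without zero divisors, the factors 3 can be split off one by one until one of them vanishes;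
  -- reaching n = 0 would mean 1# ≈ 0#.
  3^n·1≈0⇒3·1≈0 : ∀ n → (3 ℕ.^ n) · 1# ≈ 0# → 3 · 1# ≈ 0#
  3^n·1≈0⇒3·1≈0 zero    eq = contradiction (trans (sym eq) (+-identityʳ 1#)) 0≉1
  3^n·1≈0⇒3·1≈0 (suc n) eq = [ id , 3^n·1≈0⇒3·1≈0 n ]′
    (xy≈0 (trans (sym (×1-homo-* 3 (3 ℕ.^ n))) eq))

  x+x+x≈0 : ∀ x → x + x + x ≈ 0#
  x+x+x≈0 x = begin
    x + x + x     ≈⟨ solve 1 (λ x → x :+ x :+ x := (con 1 :+ (con 1 :+ (con 1 :+ con 0))) :* x) refl x ⟩
    3 · 1# * x    ≈⟨ *-congʳ (3^n·1≈0⇒3·1≈0 (suc e) q·1≈0) ⟩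
    0# * x        ≈⟨ zeroˡ x ⟩
    0#            ∎

  -x≈x+x : ∀ x → - x ≈ x + x
  -x≈x+x x = sym (+-inverseˡ-unique (x + x) x (x+x+x≈0 x))

  1≉-1 : ¬ 1# ≈ - 1#
  1≉-1 1≈-1 = 0≉1 (sym (+-cancelˡ 1# 1# 0# (begin
    1# + 1#  ≈⟨ -x≈x+x 1# ⟨
    - 1#     ≈⟨ 1≈-1 ⟨
    1#       ≈⟨ +-identityʳ 1# ⟨
    1# + 0#  ∎)))

  0≉-1 : ¬ 0# ≈ - 1#
  0≉-1 0≈-1 = 0≉1 (-‿injective (trans -0#≈0# 0≈-1))

  cube-+ : ∀ x y → (x + y) ^ 3 ≈ x ^ 3 + y ^ 3
  cube-+ x y = begin
    (x + y) ^ 3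
      ≈⟨ solve 2 (λ x y → let z = x :* x :* y :+ x :* y :* y in
           (x :+ y) :^ 3 := x :^ 3 :+ y :^ 3 :+ (z :+ z :+ z)) refl x y ⟩
    x ^ 3 + y ^ 3 + (z + z + z)
      ≈⟨ +-congˡ (x+x+x≈0 z) ⟩
    x ^ 3 + y ^ 3 + 0#
      ≈⟨ +-identityʳ _ ⟩
    x ^ 3 + y ^ 3 ∎
    where z = x * x * y + x * y * y

  -- The product of the nonzero elements is invariant under multiplication by x ≠ 0.
  x^q≈x : ∀ x → x ^ q ≈ x
  x^q≈x x with x ≟ 0#
  ... | yes x≈0 = begin
    x ^ q             ≈⟨ ^-congˡ q x≈0 ⟩
    0# ^ q            ≈⟨ 0^ (ℕₚ.m^n>0 3 (suc e)) ⟩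
    0#                ≈⟨ x≈0 ⟨
    x                 ∎
    where
    0^ : ∀ {n} → 0 < n → 0# ^ n ≈ 0#
    0^ (s≤s _) = zeroˡ _
  ... | no x≉0 = *-cancelˡ (∏ unit) ∏unit≉0 (begin
    ∏ unit * x ^ q                  ≈⟨ *-congˡ (KΠ.sum-replicate q) ⟨
    ∏ unit * ∏ (λ _ → x)            ≈⟨ K∏.∑-∙ unit (λ _ → x) ⟨
    ∏ (λ y → unit y * x)            ≈⟨ K∏.∑-cong split ⟨
    ∏ (λ y → unit (x * y) * at0 y)  ≈⟨ K∏.∑-∙ (unit ∘ (x *_)) at0 ⟩
    ∏ (unit ∘ (x *_)) * ∏ at0       ≈⟨ *-cong (sym permuted) ∏at0≈x ⟩
    ∏ unit * x                      ∎)
    where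
    x⁻¹ = proj₁ (inverse x x≉0)
    x⁻¹x≈1 = proj₂ (inverse x x≉0)

    -- The product has to run over the whole field, so `unit` puts 1# in the place of 0#. Scaling
    -- all q factors by x then gives one x too many, the one at 0#; `at0` accounts for it.
    unit at0 : K → K
    unit y = if does (y ≟ 0#) then 1# else y
    at0  y = if does (y ≟ 0#) then x else 1#

    unit-cong : ∀ {y z} → y ≈ z → unit y ≈ unit z
    unit-cong {y} {z} y≈z with y ≟ 0# | z ≟ 0#
    ... | yes _   | yes _   = refl
    ... | yes y≈0 | no  z≉0 = contradiction (trans (sym y≈z) y≈0) z≉0
    ... | no  y≉0 | yes z≈0 = contradiction (trans y≈z z≈0) y≉0
    ... | no  _   | no  _   = y≈z

    at0-cong : ∀ {y z} → y ≈ z → at0 y ≈ at0 z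
    at0-cong {y} {z} y≈z with y ≟ 0# | z ≟ 0#
    ... | yes _   | yes _   = refl
    ... | yes y≈0 | no  z≉0 = contradiction (trans (sym y≈z) y≈0) z≉0
    ... | no  y≉0 | yes z≈0 = contradiction (trans y≈z z≈0) y≉0
    ... | no  _   | no  _   = refl

    unit≉0 : ∀ y → ¬ unit y ≈ 0#
    unit≉0 y with y ≟ 0#
    ... | yes _   = 0≉1 ∘ sym
    ... | no  y≉0 = y≉0

    ∏unit≉0 : ¬ ∏ unit ≈ 0#
    ∏unit≉0 = prod≉0 (unit ∘ from) (unit≉0 ∘ from)

    nzd : ∀ {y} → ¬ y ≈ 0# → ¬ x * y ≈ 0#
    nzd y≉0 eq = [ x≉0 , y≉0 ]′ (xy≈0 eq)

    split : ∀ y → unit (x * y) * at0 y ≈ unit y * x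
    split y with y ≟ 0# | x * y ≟ 0#
    ... | yes y≈0 | yes _    = refl
    ... | yes y≈0 | no xy≉0  = contradiction (trans (*-congˡ y≈0) (zeroʳ x)) xy≉0
    ... | no  y≉0 | yes xy≈0 = contradiction xy≈0 (nzd y≉0)
    ... | no  y≉0 | no  _    = trans (*-identityʳ _) (*-comm x y)

    permuted : ∏ unit ≈ ∏ (unit ∘ (x *_))
    permuted = K∏.∑-bijection (x *_) (x⁻¹ *_) unit-cong *-congˡ *-congˡ
      (λ y → trans (sym (*-assoc x x⁻¹ y)) (trans (*-congʳ (trans (*-comm x x⁻¹) x⁻¹x≈1)) (*-identityˡ y)))
      (λ y → trans (sym (*-assoc x⁻¹ x y)) (trans (*-congʳ x⁻¹x≈1) (*-identityˡ y)))

    ∏at0≈x : ∏ at0 ≈ x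
    ∏at0≈x = trans (K∏.∑-single 0# at0-cong at0≈1) at0[0]
      where
      at0≈1 : ∀ y → ¬ y ≈ 0# → at0 y ≈ 1#
      at0≈1 y y≉0 with y ≟ 0#
      ... | yes y≈0 = contradiction y≈0 y≉0
      ... | no _    = refl
      at0[0] : at0 0# ≈ x
      at0[0] with 0# ≟ 0#
      ... | yes _  = refl
      ... | no 0≉0 = contradiction refl 0≉0

  -- Counting in the field; polynomial functions and their roots

  # : {P : K → Set ℓᵖ} → (∀ x → Dec (P x)) → ℕ
  # P? = ∑ (λ x → ⟦ P? x ⟧)

  ∑-const : ∀ k → ∑ (λ _ → k) ≡ q ℕ.* k
  ∑-const k = sum-const q k

  #-≈ : ∀ a → # (_≟ a) ≡ 1
  #-≈ a = ≡.trans
    (ℕ∑.∑-single a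
      (λ {x} {y} x≈y → ⟦⟧-cong (x ≟ a) (y ≟ a) (trans (sym x≈y)) (trans x≈y))
      (λ x → ⟦no⟧ (x ≟ a)))
    (⟦yes⟧ (a ≟ a) refl)

  -- f is a polynomial function of degree at most n whose coefficient at xⁿ is a.
  data Poly : ℕ → K → (K → K) → Set (c ⊔ ℓ₁) where
    const  : ∀ {a f} → (∀ x → f x ≈ a) → Poly 0 a f
    horner : ∀ {n a f g} k → Poly n a g → (∀ x → f x ≈ k + x * g x) → Poly (suc n) a f

  poly-resp : ∀ {n a b f g} → a ≈ b → (∀ x → f x ≈ g x) → Poly n a f → Poly n b g
  poly-resp a≈b f≈g (const f≈a)      = const (λ x → trans (sym (f≈g x)) (trans (f≈a x) a≈b))
  poly-resp a≈b f≈g (horner k p f≈)  =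
    horner k (poly-resp a≈b (λ _ → refl) p) (λ x → trans (sym (f≈g x)) (f≈ x))

  poly-cong : ∀ {n a f} → Poly n a f → ∀ {x y} → x ≈ y → f x ≈ f y
  poly-cong (const f≈a)     {x} {y} x≈y = trans (f≈a x) (sym (f≈a y))
  poly-cong (horner k p f≈) {x} {y} x≈y =
    trans (f≈ x) (trans (+-congˡ (*-cong x≈y (poly-cong p x≈y))) (sym (f≈ y)))

  poly-suc : ∀ {n a f} → Poly n a f → Poly (suc n) 0# f
  poly-suc {a = a} (const f≈a) = horner a (const {f = λ _ → 0#} (λ _ → refl))
    (λ x → trans (f≈a x) (sym (trans (+-congˡ (zeroʳ x)) (+-identityʳ a))))
  poly-suc (horner k p f≈) = horner k (poly-suc p) f≈

  poly-< : ∀ {m n a f} → m < n → Poly m a f → Poly n 0# f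
  poly-< {m} {n} m<n = go (ℕₚ.≤⇒≤′ m<n)
    where
    go : ∀ {n a f} → suc m ℕ.≤′ n → Poly m a f → Poly n 0# f
    go ℕ.≤′-refl         p = poly-suc p
    go (ℕ.≤′-step m<n) p = poly-suc (go m<n p)

  poly-+ : ∀ {n a b f g} → Poly n a f → Poly n b g → Poly n (a + b) (λ x → f x + g x)
  poly-+ (const f≈a) (const g≈b) = const (λ x → +-cong (f≈a x) (g≈b x))
  poly-+ (horner {g = f} j p f≈) (horner {g = g} k r g≈) = horner (j + k) (poly-+ p r) λ x →
    trans (+-cong (f≈ x) (g≈ x))
      (solve 5 (λ x j k f g → (j :+ x :* f) :+ (k :+ x :* g) := (j :+ k) :+ x :* (f :+ g))
        refl x j k (f x) (g x))

  poly-scale : ∀ {n a f} k → Poly n a f → Poly n (k * a) (λ x → k * f x)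
  poly-scale k (const f≈a) = const (λ x → *-congˡ (f≈a x))
  poly-scale k (horner {g = g} j p f≈) = horner (k * j) (poly-scale k p) λ x →
    trans (*-congˡ (f≈ x))
      (solve 4 (λ x k j g → k :* (j :+ x :* g) := k :* j :+ x :* (k :* g)) refl x k j (g x))

  poly-^ : ∀ n → Poly n 1# (_^ n)
  poly-^ zero    = const (λ _ → refl)
  poly-^ (suc n) = horner 0# (poly-^ n) (λ x → sym (+-identityˡ _))

  poly-+const : ∀ {n a f} k → 0 < n → Poly n a f → Poly n a (λ x → f x + k)
  poly-+const {a = a} k 0<n p = poly-resp (+-identityʳ a) (λ _ → refl)
    (poly-+ p (poly-< 0<n (const {a = k} {f = λ _ → k} (λ _ → refl))))

  -- Horner's scheme: if f x ≈ k + x * g x and g x ≈ g r + (x - r) * h x, then g + r h is the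
  -- quotient of f. Since r h has lower degree, the leading coefficient is still a.
  poly-divide : ∀ {n a f} → Poly (suc n) a f → ∀ r →
                ∃[ g ] Poly n a g × (∀ x → f x ≈ f r + (x - r) * g x)
  poly-divide {f = f} (horner {a = a} k (const {f = g} g≈a) f≈) r = (λ _ → a) , const (λ _ → refl) , λ x → begin
    f x                                   ≈⟨ f≈ x ⟩
    k + x * g x                           ≈⟨ +-congˡ (*-cong (sym (x-y+y≈x x r)) (g≈a x)) ⟩
    k + (x - r + r) * a                   ≈⟨ solve 4 (λ k y r a →
      k :+ (y :+ r) :* a := k :+ r :* a :+ y :* a) refl k (x - r) r a ⟩
    k + r * a + (x - r) * a               ≈⟨ +-congʳ (trans (+-congˡ (*-congˡ (sym (g≈a r)))) (sym (f≈ r))) ⟩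
    f r + (x - r) * a                     ∎
  poly-divide {f = f} (horner {a = a} {g = g} k p@(horner _ _ _) f≈) r
    with poly-divide p r
  ... | h , h-poly , g≈ = (λ x → g x + r * h x) ,
    poly-resp (+-identityʳ a) (λ _ → refl) (poly-+ p (poly-suc (poly-scale r h-poly))) , λ x → begin
    f x                                     ≈⟨ f≈ x ⟩
    k + x * g x                             ≈⟨ +-congˡ (*-congʳ (x-y+y≈x x r)) ⟨
    k + (x - r + r) * g x                   ≈⟨ solve 4 (λ k y r a →
      k :+ (y :+ r) :* a := k :+ y :* a :+ r :* a) refl k (x - r) r (g x) ⟩
    k + (x - r) * g x + r * g x             ≈⟨ +-congˡ (*-congˡ (g≈ x)) ⟩
    k + (x - r) * g x + r * (g r + (x - r) * h x)
      ≈⟨ solve 6 (λ k y gx r gr hx → k :+ y :* gx :+ r :* (gr :+ y :* hx) :=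
                 k :+ r :* gr :+ y :* (gx :+ r :* hx)) refl k (x - r) (g x) r (g r) (h x) ⟩
    k + r * g r + (x - r) * (g x + r * h x) ≈⟨ +-congʳ (f≈ r) ⟨
    f r + (x - r) * (g x + r * h x)         ∎

  poly-root : ∀ {n a f} → Poly n a f → ¬ a ≈ 0# →
              (∀ x → ¬ f x ≈ 0#) ⊎
              (∃[ m ] n ≡ suc m × ∃[ r ] f r ≈ 0# × ∃[ g ] Poly m a g × (∀ x → f x ≈ (x - r) * g x))
  poly-root (const f≈a) a≉0 = inj₁ (λ x fx≈0 → a≉0 (trans (sym (f≈a x)) fx≈0))
  poly-root {f = f} p@(horner _ _ _) a≉0 with Finₚ.any? (λ i → f (from i) ≟ 0#)
  ... | no none = inj₁ λ x fx≈0 → none (to x , trans (poly-cong p (strictlyInverseʳ x)) fx≈0)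
  ... | yes (i , fr≈0) with poly-divide p (from i)
  ... | g , g-poly , f≈ = inj₂ (_ , ≡.refl , from i , fr≈0 , g , g-poly ,
    λ x → trans (f≈ x) (trans (+-congʳ fr≈0) (+-identityˡ _)))

  module _ {f g : K → K} {r} (f≈ : ∀ x → f x ≈ (x - r) * g x) where
    root-split : ∀ x → ⟦ f x ≟ 0# ⟧ ≤ ⟦ x ≟ r ⟧ ℕ.+ ⟦ g x ≟ 0# ⟧
    root-split x = ⟦⟧-⊎ (f x ≟ 0#) (x ≟ r) (g x ≟ 0#) λ fx≈0 →
      [ inj₁ ∘ x-y≈0⇒x≈y , inj₂ ]′ (xy≈0 (trans (sym (f≈ x)) fx≈0))

    ∑-root-split : ∑ (λ x → ⟦ x ≟ r ⟧ ℕ.+ ⟦ g x ≟ 0# ⟧) ≡ suc (# (λ x → g x ≟ 0#))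
    ∑-root-split = ≡.trans (ℕ∑.∑-∙ (λ x → ⟦ x ≟ r ⟧) (λ x → ⟦ g x ≟ 0# ⟧))
      (cong (ℕ._+ # (λ x → g x ≟ 0#)) (#-≈ r))

  ∑-zero : ∀ {f} → (∀ x → f x ≡ 0) → ∑ f ≡ 0
  ∑-zero f≡0 = sum-zero ℕₚ.+-0-commutativeMonoid _ (f≡0 ∘ from)

  #roots≤degree : ∀ {n a f} → Poly n a f → ¬ a ≈ 0# → # (λ x → f x ≟ 0#) ≤ n
  #roots≤degree {n} {f = f} p a≉0 with poly-root p a≉0
  ... | inj₁ none = subst (_≤ n) (≡.sym (∑-zero λ x → ⟦no⟧ (f x ≟ 0#) (none x))) z≤n
  ... | inj₂ (m , ≡.refl , r , _ , g , g-poly , f≈) = ℕₚ.≤-trans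
    (sum-mono-≤ (root-split f≈ ∘ from))
    (ℕₚ.≤-trans (ℕₚ.≤-reflexive (∑-root-split f≈)) (s≤s (#roots≤degree g-poly a≉0)))

  select : Dec P → K → K
  select p? x = if does p? then x else 1#

  select-cong : (p? : Dec P) (r? : Dec R) → (P → R) → (R → P) →
                ∀ {x y} → x ≈ y → select p? x ≈ select r? y
  select-cong (yes _) (yes _) _ _ x≈y = x≈y
  select-cong (yes p) (no ¬r) f _ _   = contradiction (f p) ¬r
  select-cong (no ¬p) (yes r) _ g _   = contradiction (g r) ¬p
  select-cong (no _)  (no _)  _ _ _   = refl

  select-no : (p? : Dec P) → ¬ P → ∀ {x} → select p? x ≈ 1#
  select-no (yes p) ¬p = contradiction p ¬p
  select-no (no _)  _  = refl

  select-yes : (p? : Dec P) → P → ∀ {x} → select p? x ≈ x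
  select-yes (yes _) _ = refl
  select-yes (no ¬p) p = contradiction p ¬p

  select-+ : (p? : Dec P) (r? : Dec R) (s? : Dec R′) → ⟦ p? ⟧ ≡ ⟦ r? ⟧ ℕ.+ ⟦ s? ⟧ →
             ∀ x → select p? x ≈ select r? x * select s? x
  select-+ (yes _) (yes _) (no _)  _ x = sym (*-identityʳ x)
  select-+ (yes _) (no _)  (yes _) _ x = sym (*-identityˡ x)
  select-+ (no _)  (no _)  (no _)  _ x = sym (*-identityˡ 1#)

  -- Split off a root r and recurse on the quotient. With as many distinct roots as the degree
  -- allows, r cannot be a root of the quotient again, so the factors over distinct roots are all
  -- the factors.
  factorisation : ∀ {n a f} → Poly n a f → ¬ a ≈ 0# → n ≤ # (λ x → f x ≟ 0#) →
                  ∀ x → f x ≈ a * ∏ (λ r → select (f r ≟ 0#) (x - r))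
  factorisation {a = a} {f} (const f≈a) a≉0 _ x = begin
    f x      ≈⟨ f≈a x ⟩
    a        ≈⟨ *-identityʳ a ⟨
    a * 1#   ≈⟨ *-congˡ (sum-zero *-commutativeMonoid _ λ i → select-no (f (from i) ≟ 0#)
                  λ eq → a≉0 (trans (sym (f≈a _)) eq)) ⟨
    a * ∏ (λ r → select (f r ≟ 0#) (x - r)) ∎
  factorisation {f = f} p@(horner _ _ _) a≉0 n≤#roots x with poly-root p a≉0
  ... | inj₁ none = contradiction
    (subst (1 ≤_) (∑-zero λ x → ⟦no⟧ (f x ≟ 0#) (none x)) (ℕₚ.≤-trans (s≤s z≤n) n≤#roots)) λ ()
  ... | inj₂ (m , ≡.refl , r , _ , g , g-poly , f≈) = begin
    f x
      ≈⟨ f≈ x ⟩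
    (x - r) * g x
      ≈⟨ *-cong ∏-linear (factorisation g-poly a≉0 m≤#roots x) ⟩
    ∏ linear * (_ * ∏ rest)
      ≈⟨ solve 3 (λ x y z → x :* (y :* z) := y :* (x :* z)) refl (∏ linear) _ (∏ rest) ⟩
    _ * (∏ linear * ∏ rest)
      ≈⟨ *-congˡ (K∏.∑-∙ linear rest) ⟨
    _ * ∏ (λ s → linear s * rest s)
      ≈⟨ *-congˡ (KΠ.sum-cong-≋ {q} λ i →
           select-+ (f (from i) ≟ 0#) (from i ≟ r) (g (from i) ≟ 0#) (tight-split i) (x - from i)) ⟨
    _ * ∏ (λ s → select (f s ≟ 0#) (x - s)) ∎
    where
    linear rest : K → K
    linear s = select (s ≟ r) (x - s)
    rest s = select (g s ≟ 0#) (x - s)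

    ∏-linear : x - r ≈ ∏ linear
    ∏-linear = sym (trans
      (K∏.∑-single r
        (λ {s} {t} s≈t → select-cong (s ≟ r) (t ≟ r) (trans (sym s≈t)) (trans s≈t) (+-congˡ (-‿cong s≈t)))
        (λ s s≉r → select-no (s ≟ r) s≉r))
      (select-yes (r ≟ r) refl))

    n≤1+#g : suc m ≤ suc (# (λ x → g x ≟ 0#))
    n≤1+#g = ℕₚ.≤-trans n≤#roots
      (ℕₚ.≤-trans (sum-mono-≤ (root-split f≈ ∘ from)) (ℕₚ.≤-reflexive (∑-root-split f≈)))

    m≤#roots : m ≤ # (λ x → g x ≟ 0#)
    m≤#roots = ℕ.s≤s⁻¹ n≤1+#g

    -- `root-split` is only an inequality, since r might also be a root of g. The number of roots of
    -- f makes the totals agree, hence the two sides at every point.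
    tight-split : ∀ i → ⟦ f (from i) ≟ 0# ⟧ ≡ ⟦ from i ≟ r ⟧ ℕ.+ ⟦ g (from i) ≟ 0# ⟧
    tight-split = sum-mono-≤-tight (root-split f≈ ∘ from) (ℕₚ.≤-trans
      (ℕₚ.≤-reflexive (∑-root-split f≈)) (ℕₚ.≤-trans (s≤s (#roots≤degree g-poly a≉0)) n≤#roots))

  -- Frobenius and the trace

  frobenius-+ : ∀ k x y → (x + y) ^ (3 ℕ.^ k) ≈ x ^ (3 ℕ.^ k) + y ^ (3 ℕ.^ k)
  frobenius-+ zero    x y = trans (*-identityʳ _) (sym (+-cong (*-identityʳ x) (*-identityʳ y)))
  frobenius-+ (suc k) x y = begin
    (x + y) ^ (3 ℕ.* 3 ℕ.^ k)                        ≈⟨ ^-assocʳ (x + y) 3 (3 ℕ.^ k) ⟨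
    ((x + y) ^ 3) ^ (3 ℕ.^ k)                        ≈⟨ ^-congˡ (3 ℕ.^ k) (cube-+ x y) ⟩
    (x ^ 3 + y ^ 3) ^ (3 ℕ.^ k)                      ≈⟨ frobenius-+ k (x ^ 3) (y ^ 3) ⟩
    (x ^ 3) ^ (3 ℕ.^ k) + (y ^ 3) ^ (3 ℕ.^ k)
      ≈⟨ +-cong (^-assocʳ x 3 (3 ℕ.^ k)) (^-assocʳ y 3 (3 ℕ.^ k)) ⟩
    x ^ (3 ℕ.* 3 ℕ.^ k) + y ^ (3 ℕ.* 3 ℕ.^ k)        ∎

  0^3≈0 : 0# ^ 3 ≈ 0#
  0^3≈0 = zeroˡ _

  cube-sum : (f : Fin n → K) → KΣ.sum f ^ 3 ≈ KΣ.sum (λ i → f i ^ 3)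
  cube-sum {n = zero}  f = 0^3≈0
  cube-sum {n = suc n} f = trans (cube-+ (f zero) (KΣ.sum (f ∘ suc))) (+-congˡ (cube-sum (f ∘ suc)))

  T : K → K
  T = Tr F (suc e)

  Tr-suc : ∀ d x → Tr F (suc d) x ≈ Tr F d x + x ^ (3 ℕ.^ d)
  Tr-suc d x = trans (KΣ.sum-init-last (λ (i : Fin (suc d)) → x ^ (3 ℕ.^ toℕ i)))
    (+-cong (KΣ.sum-cong-≋ {d} λ i → ^-congʳ x (cong (3 ℕ.^_) (Finₚ.toℕ-inject₁ i)))
            (^-congʳ x (cong (3 ℕ.^_) (Finₚ.toℕ-fromℕ d))))

  -- The last conjugate has larger degree than all earlier ones together, so the sum stays monic.
  poly-Tr : ∀ k → Poly (3 ℕ.^ k) 1# (Tr F (suc k))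
  poly-Tr zero    = poly-resp refl (λ x → trans (sym (+-identityʳ _)) refl) (poly-^ 1)
  poly-Tr (suc k) = poly-resp (+-identityˡ 1#) (λ x → sym (Tr-suc (suc k) x))
    (poly-+ (poly-< (ℕₚ.^-monoʳ-< 3 (s≤s (s≤s z≤n)) (ℕₚ.n<1+n k)) (poly-Tr k)) (poly-^ (3 ℕ.^ suc k)))

  T-cong : ∀ {x y} → x ≈ y → T x ≈ T y
  T-cong = poly-cong (poly-Tr e)

  T-+ : ∀ x y → T (x + y) ≈ T x + T y
  T-+ x y = trans (KΣ.sum-cong-≋ {suc e} (λ i → frobenius-+ (toℕ i) x y))
    (KΣ.∑-distrib-+ {suc e} (λ i → x ^ (3 ℕ.^ toℕ i)) (λ i → y ^ (3 ℕ.^ toℕ i)))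

  T-0 : T 0# ≈ 0#
  T-0 = +-identityʳ-unique (T 0#) (T 0#) (trans (sym (T-+ 0# 0#)) (T-cong (+-identityˡ 0#)))

  T-neg : ∀ x → T (- x) ≈ - T x
  T-neg x = +-inverseˡ-unique (T (- x)) (T x)
    (trans (sym (T-+ (- x) x)) (trans (T-cong (-‿inverseˡ x)) T-0))

  T-sub : ∀ x y → T (x - y) ≈ T x - T y
  T-sub x y = trans (T-+ x (- y)) (+-congˡ (T-neg y))

  -- The sum of one conjugate more than in T, split at either end, is x + T (x ^ 3) or T x + x ^ q,
  -- and x ^ q is x.
  T-cube : ∀ x → T (x ^ 3) ≈ T x
  T-cube x = +-cancelˡ x (T (x ^ 3)) (T x) (begin
    x + T (x ^ 3)
      ≈⟨ +-cong (sym (*-identityʳ x)) (KΣ.sum-cong-≋ {suc e} λ i → ^-assocʳ x 3 (3 ℕ.^ toℕ i)) ⟩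
    Tr F (suc (suc e)) x
      ≈⟨ Tr-suc (suc e) x ⟩
    T x + x ^ q
      ≈⟨ +-congˡ (x^q≈x x) ⟩
    T x + x
      ≈⟨ +-comm (T x) x ⟩
    x + T x ∎)

  -- Cubing is additive, so it can be moved inside the sum, where it turns T x into T (x ^ 3). An
  -- element fixed by cubing lies in the prime field.
  T-^3 : ∀ x → T x ^ 3 ≈ T x
  T-^3 x = trans (cube-sum {suc e} (λ i → x ^ (3 ℕ.^ toℕ i)))
    (trans (KΣ.sum-cong-≋ {suc e} (λ i → begin
      (x ^ (3 ℕ.^ toℕ i)) ^ 3   ≈⟨ ^-assocʳ x (3 ℕ.^ toℕ i) 3 ⟩
      x ^ (3 ℕ.^ toℕ i ℕ.* 3)   ≈⟨ ^-congʳ x (ℕₚ.*-comm (3 ℕ.^ toℕ i) 3) ⟩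
      x ^ (3 ℕ.* 3 ℕ.^ toℕ i)   ≈⟨ ^-assocʳ x 3 (3 ℕ.^ toℕ i) ⟨
      (x ^ 3) ^ (3 ℕ.^ toℕ i)   ∎))
    (T-cube x))

  data Is𝔽₃ (x : K) : Set ℓ₁ where
    is0  : x ≈ 0# → Is𝔽₃ x
    is1  : x ≈ 1# → Is𝔽₃ x
    is-1 : x ≈ - 1# → Is𝔽₃ x

  x³≈x⇒𝔽₃ : ∀ {x} → x ^ 3 ≈ x → Is𝔽₃ x
  x³≈x⇒𝔽₃ {x} x³≈x with x ≟ 0#
  ... | yes x≈0 = is0 x≈0
  ... | no  x≉0 = [ is1 , is-1 ]′ (x²≈1 (*-cancelˡ x x≉0 (begin
    x * (x * x)  ≈⟨ *-congˡ (*-congˡ (*-identityʳ x)) ⟨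
    x ^ 3        ≈⟨ x³≈x ⟩
    x            ≈⟨ *-identityʳ x ⟨
    x * 1#       ∎)))

  T∈𝔽₃ : ∀ x → Is𝔽₃ (T x)
  T∈𝔽₃ x = x³≈x⇒𝔽₃ (T-^3 x)

  module _ (g : K → ℕ) (g-cong : ∀ {x y} → x ≈ y → g x ≡ g y) where
    𝔽₃-expand : ∀ {x} → Is𝔽₃ x →
      g x ≡ ⟦ x ≟ 0# ⟧ ℕ.* g 0# ℕ.+ ⟦ x ≟ 1# ⟧ ℕ.* g 1# ℕ.+ ⟦ x ≟ - 1# ⟧ ℕ.* g (- 1#)
    𝔽₃-expand {x} (is0 x≈0)
      rewrite ⟦yes⟧ (x ≟ 0#) x≈0 | ⟦no⟧ (x ≟ 1#) (0≉1 ∘ trans (sym x≈0))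
            | ⟦no⟧ (x ≟ - 1#) (0≉-1 ∘ trans (sym x≈0)) =
      ≡.trans (g-cong x≈0) (≡.sym (≡.trans (ℕₚ.+-identityʳ _) (≡.trans (ℕₚ.+-identityʳ _) (ℕₚ.+-identityʳ _))))
    𝔽₃-expand {x} (is1 x≈1)
      rewrite ⟦no⟧ (x ≟ 0#) (λ x≈0 → 0≉1 (trans (sym x≈0) x≈1)) | ⟦yes⟧ (x ≟ 1#) x≈1
            | ⟦no⟧ (x ≟ - 1#) (1≉-1 ∘ trans (sym x≈1)) =
      ≡.trans (g-cong x≈1) (≡.sym (≡.trans (ℕₚ.+-identityʳ _) (ℕₚ.+-identityʳ _)))
    𝔽₃-expand {x} (is-1 x≈-1)
      rewrite ⟦no⟧ (x ≟ 0#) (λ x≈0 → 0≉-1 (trans (sym x≈0) x≈-1))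
            | ⟦no⟧ (x ≟ 1#) (λ x≈1 → 1≉-1 (trans (sym x≈1) x≈-1)) | ⟦yes⟧ (x ≟ - 1#) x≈-1 =
      ≡.trans (g-cong x≈-1) (≡.sym (ℕₚ.+-identityʳ _))

    ∑-𝔽₃ : (t : K → K) → (∀ x → Is𝔽₃ (t x)) →
      ∑ (g ∘ t) ≡ # (λ x → t x ≟ 0#) ℕ.* g 0# ℕ.+ # (λ x → t x ≟ 1#) ℕ.* g 1#
                  ℕ.+ # (λ x → t x ≟ - 1#) ℕ.* g (- 1#)
    ∑-𝔽₃ t t∈𝔽₃ = ≡.trans (ℕ∑.∑-cong (λ x → 𝔽₃-expand (t∈𝔽₃ x)))
      (≡.trans (ℕ∑.∑-∙ (λ x → χ 0# x ℕ.+ χ 1# x) (χ (- 1#)))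
        (cong₂ ℕ._+_ (≡.trans (ℕ∑.∑-∙ (χ 0#) (χ 1#)) (cong₂ ℕ._+_ (pull 0#) (pull 1#))) (pull (- 1#))))
      where
      χ : K → K → ℕ
      χ a x = ⟦ t x ≟ a ⟧ ℕ.* g a
      pull : ∀ a → ∑ (χ a) ≡ # (λ x → t x ≟ a) ℕ.* g a
      pull a = ≡.sym (ℕΣ.*-distribʳ-sum {q} (g a) (λ i → ⟦ t (from i) ≟ a ⟧))

  ∑-𝔽₃-count : (t : K → K) → (∀ x → Is𝔽₃ (t x)) →
    # (λ x → t x ≟ 0#) ℕ.+ # (λ x → t x ≟ 1#) ℕ.+ # (λ x → t x ≟ - 1#) ≡ q
  ∑-𝔽₃-count t t∈𝔽₃ = ≡.trans
    (≡.sym (cong₂ ℕ._+_ (cong₂ ℕ._+_ (*1 0#) (*1 1#)) (*1 (- 1#))))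
    (≡.trans (≡.sym (∑-𝔽₃ (λ _ → 1) (λ _ → ≡.refl) t t∈𝔽₃)) (≡.trans (∑-const 1) (ℕₚ.*-identityʳ q)))
    where
    *1 : ∀ a → # (λ x → t x ≟ a) ℕ.* 1 ≡ # (λ x → t x ≟ a)
    *1 a = ℕₚ.*-identityʳ (# (λ x → t x ≟ a))

  0<Q : 0 < Q
  0<Q = ℕₚ.m^n>0 3 e

  1≉0 : ¬ 1# ≈ 0#
  1≉0 = 0≉1 ∘ sym

  #fibre≤degree : ∀ {n f} → 0 < n → Poly n 1# f → ∀ u → # (λ x → f x ≟ u) ≤ n
  #fibre≤degree {n} {f} 0<n p u = ℕₚ.≤-trans
    (sum-mono-≤ λ i → ⟦⟧-mono (f (from i) ≟ u) (f (from i) - u ≟ 0#) x≈y⇒x-y≈0)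
    (#roots≤degree (poly-+const (- u) 0<n p) 1≉0)

  -- The degree of the trace bounds each fibre by Q, and the three fibres together exhaust the 3 Q
  -- elements of the field.
  #T-all : # (λ x → T x ≟ 0#) ≡ Q × # (λ x → T x ≟ 1#) ≡ Q × # (λ x → T x ≟ - 1#) ≡ Q
  #T-all = all-tight (#fibre≤degree 0<Q (poly-Tr e) 0#) (#fibre≤degree 0<Q (poly-Tr e) 1#)
    (#fibre≤degree 0<Q (poly-Tr e) (- 1#)) (∑-𝔽₃-count T T∈𝔽₃)

  -- Fibres of x³ - x and of squaring

  ∑-fibres : (φ : K → K) (f : K → ℕ) → (∀ {x y} → x ≈ y → f x ≡ f y) →
             ∑ (f ∘ φ) ≡ ∑ (λ u → # (λ x → φ x ≟ u) ℕ.* f u)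
  ∑-fibres φ f f-cong = ≡.sym (≡.trans
    (ℕ∑.∑-cong λ u → ℕΣ.*-distribʳ-sum {q} (f u) (λ i → ⟦ φ (from i) ≟ u ⟧))
    (≡.trans (ℕΣ.∑-comm {q} {q} (λ i j → ⟦ φ (from j) ≟ from i ⟧ ℕ.* f (from i)))
      (ℕ∑.∑-cong λ x → ≡.trans
        (ℕ∑.∑-single {λ u → ⟦ φ x ≟ u ⟧ ℕ.* f u} (φ x)
          (λ {u} {v} u≈v → cong₂ ℕ._*_
            (⟦⟧-cong (φ x ≟ u) (φ x ≟ v) (λ eq → trans eq u≈v) (λ eq → trans eq (sym u≈v))) (f-cong u≈v))
          (λ u u≉φx → cong (ℕ._* f u) (⟦no⟧ (φ x ≟ u) (u≉φx ∘ sym))))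
        (≡.trans (cong (ℕ._* f (φ x)) (⟦yes⟧ (φ x ≟ φ x) refl)) (ℕₚ.+-identityʳ _)))))

  ∑1≡q : ∑ (λ _ → 1) ≡ q
  ∑1≡q = ≡.trans (∑-const 1) (ℕₚ.*-identityʳ q)

  ∑-tight : ∀ {f g} → (∀ {x y} → x ≈ y → f x ≡ f y) → (∀ {x y} → x ≈ y → g x ≡ g y) →
            (∀ x → f x ≤ g x) → ∑ g ≤ ∑ f → ∀ x → f x ≡ g x
  ∑-tight f-cong g-cong f≤g ∑g≤∑f x = ≡.trans (f-cong (sym (strictlyInverseʳ x)))
    (≡.trans (sum-mono-≤-tight (f≤g ∘ from) ∑g≤∑f (to x)) (g-cong (strictlyInverseʳ x)))

  #-cong : ∀ (φ : K → K) {u v} → u ≈ v → # (λ x → φ x ≟ u) ≡ # (λ x → φ x ≟ v)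
  #-cong φ {u} {v} u≈v = ℕ∑.∑-cong λ x →
    ⟦⟧-cong (φ x ≟ u) (φ x ≟ v) (λ eq → trans eq u≈v) (λ eq → trans eq (sym u≈v))

  ≟-cong : ∀ {w u v} → u ≈ v → ⟦ u ≟ w ⟧ ≡ ⟦ v ≟ w ⟧
  ≟-cong {w} {u} {v} u≈v = ⟦⟧-cong (u ≟ w) (v ≟ w) (trans (sym u≈v)) (trans u≈v)

  ∑-#fibres : ∀ φ → ∑ (λ u → # (λ x → φ x ≟ u)) ≡ q
  ∑-#fibres φ = ≡.trans (ℕ∑.∑-cong λ u → ≡.sym (ℕₚ.*-identityʳ (# (λ x → φ x ≟ u))))
    (≡.trans (≡.sym (∑-fibres φ (λ _ → 1) (λ _ → ≡.refl))) ∑1≡q)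

  -- Both sides sum to q over u, so the pointwise upper bound is attained.
  #[x³-x≈u] : ∀ u → # (λ x → x ^ 3 - x ≟ u) ≡ 3 ℕ.* ⟦ T u ≟ 0# ⟧
  #[x³-x≈u] = ∑-tight (#-cong (λ x → x ^ 3 - x)) (λ u≈v → cong (3 ℕ.*_) (≟-cong (T-cong u≈v))) bound
    (ℕₚ.≤-reflexive (≡.trans
      (≡.sym (ℕΣ.*-distribˡ-sum {q} 3 (λ i → ⟦ T (from i) ≟ 0# ⟧)))
      (≡.trans (cong (3 ℕ.*_) (proj₁ #T-all)) (≡.sym (∑-#fibres (λ x → x ^ 3 - x))))))
    where
    x³-x-poly : Poly 3 1# (λ x → x ^ 3 - x)
    x³-x-poly = poly-resp (+-identityʳ 1#) (λ x → +-congˡ (trans (-1*x≈-x _) (-‿cong (*-identityʳ x))))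
      (poly-+ (poly-^ 3) (poly-< (s≤s (s≤s z≤n)) (poly-scale (- 1#) (poly-^ 1))))

    bound : ∀ u → # (λ x → x ^ 3 - x ≟ u) ≤ 3 ℕ.* ⟦ T u ≟ 0# ⟧
    bound u with T u ≟ 0#
    ... | yes _    = #fibre≤degree (s≤s z≤n) x³-x-poly u
    ... | no  Tu≉0 = ℕₚ.≤-reflexive (∑-zero λ x → ⟦no⟧ (x ^ 3 - x ≟ u) λ eq → Tu≉0 (begin
      T u               ≈⟨ T-cong eq ⟨
      T (x ^ 3 - x)     ≈⟨ T-sub (x ^ 3) x ⟩
      T (x ^ 3) - T x   ≈⟨ x≈y⇒x-y≈0 (T-cube x) ⟩
      0#                ∎))

  -- Here h is (q - 1) / 2, the exponent of Euler's criterion. It is written in the form that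
  -- `3^-odd (suc e)` computes from Q = 1 + 2g, so that `q≡1+2h` is its second component.
  g h : ℕ
  g = proj₁ (3^-odd e)
  h = suc (3 ℕ.* g)

  q≡1+2h : q ≡ suc (2 ℕ.* h)
  q≡1+2h = proj₂ (3^-odd (suc e))

  x^h²≈1 : ∀ {x} → ¬ x ≈ 0# → x ^ h * x ^ h ≈ 1#
  x^h²≈1 {x} x≉0 = *-cancelˡ x x≉0 (begin
    x * (x ^ h * x ^ h)     ≈⟨ *-congˡ (^-homo-* x h h) ⟨
    x * x ^ (h ℕ.+ h)       ≈⟨ ^-congʳ x (cong (λ k → suc (h ℕ.+ k)) (≡.sym (ℕₚ.+-identityʳ h))) ⟩
    x ^ suc (2 ℕ.* h)       ≈⟨ ^-congʳ x q≡1+2h ⟨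
    x ^ q                   ≈⟨ x^q≈x x ⟩
    x                       ≈⟨ *-identityʳ x ⟨
    x * 1#                  ∎)

  x²^h≈1 : ∀ {x} → ¬ x ≈ 0# → (x ^ 2) ^ h ≈ 1#
  x²^h≈1 {x} x≉0 = trans (^-congˡ h (*-congˡ (*-identityʳ x))) (trans (^-distrib-* x x h) (x^h²≈1 x≉0))

  -- Euler's criterion as a formula: 0# has one square root, and the u with u ^ h ≈ 1# are the
  -- nonzero squares, with two roots each.
  #roots : K → ℕ
  #roots u = ⟦ u ≟ 0# ⟧ ℕ.+ 2 ℕ.* ⟦ u ^ h ≟ 1# ⟧

  -- Only an inequality is proved pointwise. Over all u the left side sums to q = 1 + 2h, the right
  -- side to at most 1 + 2h because u ^ h ≈ 1# has at most h solutions; so nothing is lost anywhere.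
  #[y²≈u] : ∀ u → # (λ y → y ^ 2 ≟ u) ≡ #roots u
  #[y²≈u] = ∑-tight (#-cong (_^ 2))
    (λ u≈v → cong₂ ℕ._+_ (≟-cong u≈v) (cong (2 ℕ.*_) (≟-cong (^-congˡ h u≈v)))) bound
    (ℕₚ.≤-trans (ℕₚ.≤-reflexive (ℕ∑.∑-∙ (λ u → ⟦ u ≟ 0# ⟧) (λ u → 2 ℕ.* ⟦ u ^ h ≟ 1# ⟧)))
      (ℕₚ.≤-trans (ℕₚ.+-mono-≤ (ℕₚ.≤-reflexive (#-≈ 0#))
          (ℕₚ.≤-trans (ℕₚ.≤-reflexive (≡.sym (ℕΣ.*-distribˡ-sum {q} 2 (λ i → ⟦ from i ^ h ≟ 1# ⟧))))
            (ℕₚ.*-monoʳ-≤ 2 (#fibre≤degree (s≤s z≤n) (poly-^ h) 1#))))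
        (ℕₚ.≤-reflexive (≡.trans (≡.sym q≡1+2h) (≡.sym (∑-#fibres (_^ 2)))))))
    where
    y²≈0⇒y≈0 : ∀ {y} → y ^ 2 ≈ 0# → y ≈ 0#
    y²≈0⇒y≈0 {y} eq = [ id , (λ eq → trans (sym (*-identityʳ y)) eq) ]′ (xy≈0 eq)

    bound : ∀ u → # (λ y → y ^ 2 ≟ u) ≤ #roots u
    bound u with u ≟ 0#
    ... | yes u≈0 = ℕₚ.≤-trans
      (sum-mono-≤ λ i → ⟦⟧-mono (from i ^ 2 ≟ u) (from i ≟ 0#) λ eq → y²≈0⇒y≈0 (trans eq u≈0))
      (ℕₚ.≤-trans (ℕₚ.≤-reflexive (#-≈ 0#)) (ℕₚ.m≤m+n 1 _))
    ... | no u≉0 with u ^ h ≟ 1#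
    ...   | yes _ = #fibre≤degree (s≤s z≤n) (poly-^ 2) u
    ...   | no u^h≉1 = ℕₚ.≤-reflexive (∑-zero λ y → ⟦no⟧ (y ^ 2 ≟ u) λ y²≈u →
      u^h≉1 (trans (^-congˡ h (sym y²≈u)) (x²^h≈1 λ y≈0 →
        u≉0 (trans (sym y²≈u) (trans (*-congʳ y≈0) (zeroˡ _))))))

  -- The distribution of the trace on squares

  N : K → ℕ
  N c = # (λ y → T (y ^ 2) ≟ c)

  -- By Euler's criterion these count the nonzero squares and the nonsquares of trace c.
  S S⁻ : K → ℕ
  S  c = ∑ (λ u → ⟦ u ^ h ≟ 1# ⟧ ℕ.* ⟦ T u ≟ c ⟧)
  S⁻ c = ∑ (λ u → ⟦ u ^ h ≟ - 1# ⟧ ℕ.* ⟦ T u ≟ c ⟧)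

  -- Squaring is two-to-one except over 0#, and that fibre does not enter because T 0# ≈ 0# differs
  -- from c.
  N≡2S : ∀ c → ¬ c ≈ 0# → N c ≡ 2 ℕ.* S c
  N≡2S c c≉0 = ≡.trans (∑-fibres (_^ 2) (λ u → ⟦ T u ≟ c ⟧) (≟-cong ∘ T-cong))
    (≡.trans (ℕ∑.∑-cong pointwise) (≡.sym (ℕΣ.*-distribˡ-sum {q} 2 _)))
    where
    pointwise : ∀ u → # (λ y → y ^ 2 ≟ u) ℕ.* ⟦ T u ≟ c ⟧ ≡ 2 ℕ.* (⟦ u ^ h ≟ 1# ⟧ ℕ.* ⟦ T u ≟ c ⟧)
    pointwise u = ≡.trans (cong (ℕ._* ⟦ T u ≟ c ⟧) (#[y²≈u] u)) (lemma (u ≟ 0#) (T u ≟ c))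
      where
      lemma : (u≟0 : Dec (u ≈ 0#)) (Tu≟c : Dec (T u ≈ c)) →
        (⟦ u≟0 ⟧ ℕ.+ 2 ℕ.* ⟦ u ^ h ≟ 1# ⟧) ℕ.* ⟦ Tu≟c ⟧ ≡ 2 ℕ.* (⟦ u ^ h ≟ 1# ⟧ ℕ.* ⟦ Tu≟c ⟧)
      lemma (yes u≈0) (yes Tu≈c) = contradiction (trans (sym Tu≈c) (trans (T-cong u≈0) T-0)) c≉0
      lemma (no _)    Tu≟c       = ℕₚ.*-assoc 2 ⟦ u ^ h ≟ 1# ⟧ ⟦ Tu≟c ⟧
      lemma (yes _)   (no _)     = ≡.trans (ℕₚ.*-zeroʳ (1 ℕ.+ 2 ℕ.* ⟦ u ^ h ≟ 1# ⟧))
        (cong (2 ℕ.*_) (≡.sym (ℕₚ.*-zeroʳ ⟦ u ^ h ≟ 1# ⟧)))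

  N-cong : ∀ {c c′} → c ≈ c′ → N c ≡ N c′
  N-cong = #-cong (λ y → T (y ^ 2))

  ∑N≡q : N 0# ℕ.+ N 1# ℕ.+ N (- 1#) ≡ q
  ∑N≡q = ∑-𝔽₃-count (λ y → T (y ^ 2)) (λ y → T∈𝔽₃ (y ^ 2))

  -- Multiplication by t ≠ 0 permutes the field, which leaves Q solutions; for t = 0 all q elements
  -- qualify. The indicator terms avoid subtraction in ℕ and, summed over t, become the lone Q and q
  -- in `∑N²`.
  #[T[ts]≈0] : ∀ t → # (λ s → T (t * s) ≟ 0#) ℕ.+ Q ℕ.* ⟦ t ≟ 0# ⟧ ≡ Q ℕ.+ q ℕ.* ⟦ t ≟ 0# ⟧
  #[T[ts]≈0] t with t ≟ 0#
  ... | yes t≈0 = ≡.trans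
    (cong₂ ℕ._+_
      (≡.trans (ℕ∑.∑-cong λ s → ⟦yes⟧ (T (t * s) ≟ 0#)
          (trans (T-cong (trans (*-congʳ t≈0) (zeroˡ s))) T-0)) ∑1≡q)
      (ℕₚ.*-identityʳ Q))
    (≡.trans (ℕₚ.+-comm q Q) (cong (Q ℕ.+_) (≡.sym (ℕₚ.*-identityʳ q))))
  ... | no t≉0 = cong₂ ℕ._+_
    (≡.trans (≡.sym (ℕ∑.∑-bijection {λ s → ⟦ T s ≟ 0# ⟧} (t *_) (t⁻¹ *_) (≟-cong ∘ T-cong) *-congˡ *-congˡ
      (λ y → trans (sym (*-assoc t t⁻¹ y)) (trans (*-congʳ (trans (*-comm t t⁻¹) t⁻¹t≈1)) (*-identityˡ y)))
      (λ y → trans (sym (*-assoc t⁻¹ t y)) (trans (*-congʳ t⁻¹t≈1) (*-identityˡ y)))))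
      (proj₁ #T-all))
    (≡.trans (ℕₚ.*-zeroʳ Q) (≡.sym (ℕₚ.*-zeroʳ q)))
    where
    t⁻¹ = proj₁ (inverse t t≉0)
    t⁻¹t≈1 = proj₂ (inverse t t≉0)

  -- In characteristic 3 the cross term 2 t z is - t z. The remaining factor t - z is convenient
  -- because z ↦ t - z is its own inverse.
  [t+z]² : ∀ t z → (t + z) ^ 2 ≈ z ^ 2 + t * (t - z)
  [t+z]² t z = begin
    (t + z) ^ 2                     ≈⟨ solve 2 (λ t z →
      (t :+ z) :^ 2 := z :^ 2 :+ t :* (t :+ (z :+ z))) refl t z ⟩
    z ^ 2 + t * (t + (z + z))       ≈⟨ +-congˡ (*-congˡ (+-congˡ (-x≈x+x z))) ⟨
    z ^ 2 + t * (t - z)             ∎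

  -- Counting solutions of T (y²) = T (z²): in characteristic 3 the substitution
  -- y = t + z, z = t - s turns y² - z² into t s.
  ∑N² : N 0# ℕ.* N 0# ℕ.+ N 1# ℕ.* N 1# ℕ.+ N (- 1#) ℕ.* N (- 1#) ℕ.+ Q ≡ q ℕ.* Q ℕ.+ q
  ∑N² = begin′
    N 0# ℕ.* N 0# ℕ.+ N 1# ℕ.* N 1# ℕ.+ N (- 1#) ℕ.* N (- 1#) ℕ.+ Q
      ≡⟨ cong (ℕ._+ Q) (≡.sym (∑-𝔽₃ N N-cong (λ z → T (z ^ 2)) (λ z → T∈𝔽₃ (z ^ 2)))) ⟩
    ∑ (λ z → ∑ (λ y → ⟦ T (y ^ 2) ≟ T (z ^ 2) ⟧)) ℕ.+ Q
      ≡⟨ cong (ℕ._+ Q) (ℕ∑.∑-cong λ z → ≡.trans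
           (ℕ∑.∑-bijection {λ y → ⟦ T (y ^ 2) ≟ T (z ^ 2) ⟧} (_+ z) (_- z)
             (λ eq → ≟-cong (T-cong (^-congˡ 2 eq))) +-congʳ +-congʳ
             (λ y → x-y+y≈x y z) (λ y → x+y-y≈x y z))
           (ℕ∑.∑-cong λ t → ⟦⟧-cong (T ((t + z) ^ 2) ≟ T (z ^ 2)) (T (t * (t - z)) ≟ 0#)
             (λ eq → +-identityʳ-unique (T (z ^ 2)) (T (t * (t - z))) (trans (sym (T-[t+z]² t z)) eq))
             (λ eq → trans (T-[t+z]² t z) (trans (+-congˡ eq) (+-identityʳ _))))) ⟩
    ∑ (λ z → ∑ (λ t → ⟦ T (t * (t - z)) ≟ 0# ⟧)) ℕ.+ Q
      ≡⟨ cong (ℕ._+ Q) (ℕΣ.∑-comm {q} {q} (λ i j → ⟦ T (from j * (from j - from i)) ≟ 0# ⟧)) ⟩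
    ∑ (λ t → ∑ (λ z → ⟦ T (t * (t - z)) ≟ 0# ⟧)) ℕ.+ Q
      ≡⟨ cong (ℕ._+ Q) (ℕ∑.∑-cong λ t → ≡.trans
           (ℕ∑.∑-bijection {λ z → ⟦ T (t * (t - z)) ≟ 0# ⟧} (λ s → t - s) (λ s → t - s)
             (λ eq → ≟-cong (T-cong (*-congˡ (+-congˡ (-‿cong eq)))))
             (λ eq → +-congˡ (-‿cong eq)) (λ eq → +-congˡ (-‿cong eq)) (t-[t-s]≈s t) (t-[t-s]≈s t))
           (ℕ∑.∑-cong λ s → ≟-cong (T-cong (*-congˡ (t-[t-s]≈s t s))))) ⟩
    ∑ G ℕ.+ Q
      ≡⟨ cong (∑ G ℕ.+_) (≡.sym (∑-at0 Q)) ⟩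
    ∑ G ℕ.+ ∑ (λ t → Q ℕ.* ⟦ t ≟ 0# ⟧)
      ≡⟨ ≡.sym (ℕ∑.∑-∙ G (λ t → Q ℕ.* ⟦ t ≟ 0# ⟧)) ⟩
    ∑ (λ t → G t ℕ.+ Q ℕ.* ⟦ t ≟ 0# ⟧)
      ≡⟨ ℕ∑.∑-cong #[T[ts]≈0] ⟩
    ∑ (λ t → Q ℕ.+ q ℕ.* ⟦ t ≟ 0# ⟧)
      ≡⟨ ℕ∑.∑-∙ (λ _ → Q) (λ t → q ℕ.* ⟦ t ≟ 0# ⟧) ⟩
    ∑ (λ _ → Q) ℕ.+ ∑ (λ t → q ℕ.* ⟦ t ≟ 0# ⟧)
      ≡⟨ cong₂ ℕ._+_ (∑-const Q) (∑-at0 q) ⟩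
    q ℕ.* Q ℕ.+ q ∎′
    where
    open ≡.≡-Reasoning using (step-≡-⟩) renaming (begin_ to begin′_; _∎ to _∎′)
    G : K → ℕ
    G t = # (λ s → T (t * s) ≟ 0#)

    ∑-at0 : ∀ k → ∑ (λ t → k ℕ.* ⟦ t ≟ 0# ⟧) ≡ k
    ∑-at0 k = ≡.trans (≡.sym (ℕΣ.*-distribˡ-sum {q} k (λ i → ⟦ from i ≟ 0# ⟧)))
      (≡.trans (cong (k ℕ.*_) (#-≈ 0#)) (ℕₚ.*-identityʳ k))

    T-[t+z]² : ∀ t z → T ((t + z) ^ 2) ≈ T (z ^ 2) + T (t * (t - z))
    T-[t+z]² t z = trans (T-cong ([t+z]² t z)) (T-+ (z ^ 2) (t * (t - z)))

    t-[t-s]≈s : ∀ t s → t - (t - s) ≈ s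
    t-[t-s]≈s t s = begin
      t - (t - s)        ≈⟨ +-congˡ (-‿+-comm t (- s)) ⟨
      t + (- t - - s)    ≈⟨ +-assoc t (- t) (- - s) ⟨
      t - t - - s        ≈⟨ +-cong (-‿inverseʳ t) (-‿involutive s) ⟩
      0# + s             ≈⟨ +-identityˡ s ⟩
      s                  ∎

  -- Parity of the numbers of squares and nonsquares of trace 1

  1^n≈1 : ∀ n → 1# ^ n ≈ 1#
  1^n≈1 zero    = refl
  1^n≈1 (suc n) = trans (*-identityˡ _) (1^n≈1 n)

  ∏-^ : ∀ f n → ∏ f ^ n ≈ ∏ (λ x → f x ^ n)
  ∏-^ f n = go (f ∘ from)
    where
    go : ∀ {m} (f : Fin m → K) → KΠ.sum f ^ n ≈ KΠ.sum (λ i → f i ^ n)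
    go {zero}  f = 1^n≈1 n
    go {suc m} f = trans (^-distrib-* (f zero) (KΠ.sum (f ∘ suc)) n) (*-congˡ (go (f ∘ suc)))

  ∏-const^ : ∀ x (f : K → ℕ) → ∏ (λ u → x ^ f u) ≈ x ^ ∑ f
  ∏-const^ x f = go (f ∘ from)
    where
    go : ∀ {m} (f : Fin m → ℕ) → KΠ.sum (λ i → x ^ f i) ≈ x ^ ℕΣ.sum f
    go {zero}  f = refl
    go {suc m} f = trans (*-congˡ (go (f ∘ suc))) (sym (^-homo-* x (f zero) (ℕΣ.sum (f ∘ suc))))

  -1^n≈1⇒even : ∀ n → (- 1#) ^ n ≈ 1# → ∃[ m ] n ≡ 2 ℕ.* m
  -1^n≈1⇒even 0 _ = 0 , ≡.refl
  -1^n≈1⇒even 1 eq = contradiction (trans (sym eq) (*-identityʳ _)) 1≉-1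
  -1^n≈1⇒even (suc (suc n)) eq with -1^n≈1⇒even n (begin
      (- 1#) ^ n                       ≈⟨ -‿involutive _ ⟨
      - - ((- 1#) ^ n)                 ≈⟨ -‿cong (-1*x≈-x _) ⟨
      - (- 1# * (- 1#) ^ n)            ≈⟨ -1*x≈-x _ ⟨
      - 1# * (- 1# * (- 1#) ^ n)       ≈⟨ eq ⟩
      1#                               ∎)
  ... | m , ≡.refl = suc m , cong suc (≡.sym (ℕₚ.+-suc m (m ℕ.+ 0)))

  -- The elements of trace -1 are the roots of the monic polynomial T + 1; evaluating at 0
  -- gives the product of their negatives.
  ∏[Tu≈1] : ∏ (λ u → select (T u ≟ 1#) u) ≈ 1#
  ∏[Tu≈1] = begin
    ∏ (λ u → select (T u ≟ 1#) u)
      ≈⟨ K∏.∑-cong (λ u → select-cong (T (- u) + 1# ≟ 0#) (T u ≟ 1#) (to-1 u) (from-1 u)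
           (trans (+-identityˡ _) (-‿involutive u))) ⟨
    ∏ (λ u → select (T (- u) + 1# ≟ 0#) (0# - - u))
      ≈⟨ K∏.∑-bijection {λ r → select (T r + 1# ≟ 0#) (0# - r)} -_ -_
           (λ {r} {s} r≈s → select-cong (T r + 1# ≟ 0#) (T s + 1# ≟ 0#)
             (trans (+-congʳ (sym (T-cong r≈s)))) (trans (+-congʳ (T-cong r≈s))) (+-congˡ (-‿cong r≈s)))
           -‿cong -‿cong -‿involutive -‿involutive ⟨
    ∏ (λ r → select (T r + 1# ≟ 0#) (0# - r))
      ≈⟨ *-identityˡ _ ⟨
    1# * ∏ (λ r → select (T r + 1# ≟ 0#) (0# - r))
      ≈⟨ factorisation (poly-+const 1# 0<Q (poly-Tr e)) 1≉0 (ℕₚ.≤-reflexive (≡.sym #roots-T+1)) 0# ⟨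
    T 0# + 1#
      ≈⟨ trans (+-congʳ T-0) (+-identityˡ 1#) ⟩
    1# ∎
    where
    #roots-T+1 : # (λ x → T x + 1# ≟ 0#) ≡ Q
    #roots-T+1 = ≡.trans
      (ℕ∑.∑-cong λ x → ⟦⟧-cong (T x + 1# ≟ 0#) (T x ≟ - 1#)
        (+-inverseˡ-unique (T x) 1#) (λ eq → trans (+-congʳ eq) (-‿inverseˡ 1#)))
      (proj₂ (proj₂ #T-all))

    to-1 : ∀ u → T (- u) + 1# ≈ 0# → T u ≈ 1#
    to-1 u eq = -‿injective (trans (sym (T-neg u)) (+-inverseˡ-unique (T (- u)) 1# eq))

    from-1 : ∀ u → T u ≈ 1# → T (- u) + 1# ≈ 0#
    from-1 u eq = trans (+-congʳ (trans (T-neg u) (-‿cong eq))) (-‿inverseˡ 1#)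

  Tu≈1⇒u≉0 : ∀ {u} → T u ≈ 1# → ¬ u ≈ 0#
  Tu≈1⇒u≉0 Tu≈1 u≈0 = 0≉1 (trans (sym (trans (T-cong u≈0) T-0)) Tu≈1)

  -- Raise the product of the elements of trace 1 to the power h: squares contribute 1# and
  -- nonsquares - 1#, while the product itself is 1#. Hence (- 1#) ^ S⁻ 1# is 1#, and the parity
  -- follows as 1# and - 1# differ.
  S⁻-even : ∃[ m ] S⁻ 1# ≡ 2 ℕ.* m
  S⁻-even = -1^n≈1⇒even (S⁻ 1#) (begin
    (- 1#) ^ S⁻ 1#
      ≈⟨ ∏-const^ (- 1#) (λ u → ⟦ u ^ h ≟ - 1# ⟧ ℕ.* ⟦ T u ≟ 1# ⟧) ⟨
    ∏ (λ u → (- 1#) ^ (⟦ u ^ h ≟ - 1# ⟧ ℕ.* ⟦ T u ≟ 1# ⟧))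
      ≈⟨ K∏.∑-cong pointwise ⟨
    ∏ (λ u → select (T u ≟ 1#) u ^ h)
      ≈⟨ ∏-^ (λ u → select (T u ≟ 1#) u) h ⟨
    ∏ (λ u → select (T u ≟ 1#) u) ^ h
      ≈⟨ ^-congˡ h ∏[Tu≈1] ⟩
    1# ^ h
      ≈⟨ 1^n≈1 h ⟩
    1# ∎)
    where
    pointwise : ∀ u → select (T u ≟ 1#) u ^ h ≈ (- 1#) ^ (⟦ u ^ h ≟ - 1# ⟧ ℕ.* ⟦ T u ≟ 1# ⟧)
    pointwise u with T u ≟ 1#
    ... | no _ = trans (1^n≈1 h) (sym (^-congʳ (- 1#) (ℕₚ.*-zeroʳ ⟦ u ^ h ≟ - 1# ⟧)))
    ... | yes Tu≈1 with u ^ h ≟ - 1#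
    ...   | yes eq  = trans eq (sym (*-identityʳ _))
    ...   | no  neq = [ id , (λ eq → contradiction eq neq) ]′ (x²≈1 (x^h²≈1 (Tu≈1⇒u≉0 Tu≈1)))

  S+S⁻≡Q : S 1# ℕ.+ S⁻ 1# ≡ Q
  S+S⁻≡Q = ≡.trans
    (≡.sym (ℕ∑.∑-∙ (λ u → ⟦ u ^ h ≟ 1# ⟧ ℕ.* ⟦ T u ≟ 1# ⟧) (λ u → ⟦ u ^ h ≟ - 1# ⟧ ℕ.* ⟦ T u ≟ 1# ⟧)))
    (≡.trans (ℕ∑.∑-cong pointwise) (proj₁ (proj₂ #T-all)))
    where
    pointwise : ∀ u → ⟦ u ^ h ≟ 1# ⟧ ℕ.* ⟦ T u ≟ 1# ⟧ ℕ.+ ⟦ u ^ h ≟ - 1# ⟧ ℕ.* ⟦ T u ≟ 1# ⟧ ≡ ⟦ T u ≟ 1# ⟧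
    pointwise u = ⟦⟧-split (u ^ h ≟ 1#) (u ^ h ≟ - 1#) (T u ≟ 1#)
      (λ Tu≈1 → x²≈1 (x^h²≈1 (Tu≈1⇒u≉0 Tu≈1))) (λ eq eq′ → 1≉-1 (trans (sym eq) eq′))

  S[1]-odd : ∃[ k ] S 1# ≡ suc (2 ℕ.* k)
  S[1]-odd = odd-summand (S 1#) (proj₁ S⁻-even) g (≡.trans
    (≡.trans (cong (S 1# ℕ.+_) (≡.sym (proj₂ S⁻-even))) S+S⁻≡Q) (proj₂ (3^-odd e)))

  N[1]≡2[2k+1] : ∃[ k ] N 1# ≡ 2 ℕ.* suc (2 ℕ.* k)
  N[1]≡2[2k+1] = proj₁ S[1]-odd , ≡.trans (N≡2S 1# 1≉0) (cong (2 ℕ.*_) (proj₂ S[1]-odd))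

  N[-1]≡2k : ∃[ k ] N (- 1#) ≡ 2 ℕ.* k
  N[-1]≡2k = S (- 1#) , N≡2S (- 1#) (0≉-1 ∘ sym)

  -- Points of the curve

  #affine : ∀ b → ∑ (λ x → ∑ (λ y → ⟦ y ^ 2 ≟ x ^ 3 - x + b ⟧)) ≡ 3 ℕ.* N (T b)
  #affine b = ≡.trans (ℕΣ.∑-comm {q} {q} (λ i j → ⟦ from j ^ 2 ≟ from i ^ 3 - from i + b ⟧))
    -- For fixed y the abscissae solve x³ - x = y² - b: three of them or none, according to whether
    -- y² and b have the same trace.
    (≡.trans (ℕ∑.∑-cong λ y → ≡.trans
        (≡.trans (ℕ∑.∑-cong λ x → ⟦⟧-cong (y ^ 2 ≟ x ^ 3 - x + b) (x ^ 3 - x ≟ y ^ 2 - b)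
            (λ eq → trans (sym (x+y-y≈x _ b)) (+-congʳ (sym eq)))
            (λ eq → trans (sym (x-y+y≈x _ b)) (+-congʳ (sym eq))))
          (#[x³-x≈u] (y ^ 2 - b)))
        (cong (3 ℕ.*_) (⟦⟧-cong (T (y ^ 2 - b) ≟ 0#) (T (y ^ 2) ≟ T b)
          (λ eq → x-y≈0⇒x≈y (trans (sym (T-sub (y ^ 2) b)) eq))
          (λ eq → trans (T-sub (y ^ 2) b) (x≈y⇒x-y≈0 eq)))))
      (≡.sym (ℕΣ.*-distribˡ-sum {q} 3 _)))

  #E : ∀ b → E F b HasCardinality suc (3 ℕ.* N (T b))
  #E b = subst (E F b HasCardinality_) (cong suc #points)
    (maybe-cardinality _ (subset-cardinality (setoid ×ₛ setoid) F²↔q² onCurve? onCurve-resp))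
    where
    F²↔q² = product-cardinality setoid F↔q setoid F↔q

    onCurve? : ∀ ((x , y) : K × K) → Dec (y ^ 2 ≈ x ^ 3 - x + b)
    onCurve? (x , y) = y ^ 2 ≟ x ^ 3 - x + b

    onCurve-resp : ∀ {p p′ : K × K} → Setoid._≈_ (setoid ×ₛ setoid) p p′ →
                   proj₂ p ^ 2 ≈ proj₁ p ^ 3 - proj₁ p + b → proj₂ p′ ^ 2 ≈ proj₁ p′ ^ 3 - proj₁ p′ + b
    onCurve-resp (x≈ , y≈) eq = trans (^-congˡ 2 (sym y≈))
      (trans eq (+-congʳ (+-cong (^-congˡ 3 x≈) (-‿cong x≈))))

    #points : ℕΣ.sum (λ k → ⟦ onCurve? (Inverse.from F²↔q² k) ⟧) ≡ 3 ℕ.* N (T b)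
    #points = ≡.trans (sum-combine q (λ k → ⟦ onCurve? (Inverse.from F²↔q² k) ⟧))
      (≡.trans (ℕΣ.sum-cong-≗ {q} λ i → ℕΣ.sum-cong-≗ {q} λ j →
          cong (λ (k , l) → ⟦ onCurve? (from k , from l) ⟧) (Finₚ.remQuot-combine i j))
        (#affine b))

-- The norm equation

open import Data.Integer using (ℤ; +_; -[1+_]; _+_; _-_; _*_; -_; _^_; ∣_∣; -1ℤ)
open ≡ using (refl; sym; trans)

norm : ℤ → ℤ → ℤ
norm a b = a * a + a * b + b * b

i*i≡+∣i∣² : ∀ i → i * i ≡ + (∣ i ∣ ℕ.* ∣ i ∣)
i*i≡+∣i∣² (+ n)    = sym (ℤₚ.pos-* n n)
i*i≡+∣i∣² -[1+ n ] = refl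

3∣i²⇒3∣i : ∀ i j → i * i ≡ j * + 3 → ∃[ k ] i ≡ k * + 3
3∣i²⇒3∣i i j eq with ℤ∣.∣ᵤ⇒∣ {+ 3} {i} ([ id , id ]′ (euclidsLemma ∣ i ∣ ∣ i ∣ (from-yes (prime? 3))
  (subst (λ n → 3 ∣ n) (ℤₚ.abs-* i i) (ℤ∣.∣⇒∣ᵤ (ℤ∣.divides j eq)))))
... | ℤ∣.divides k eq′ = k , eq′

-- The form equals (a - b)² + 3ab, so 3 divides a - b. With a = b + 3x it becomes 3b² + 9(bx + x²),
-- and divisibility by 9 forces 3 to divide b.
3∣norm⇒3∣ : ∀ a b M → norm a b ≡ + 9 * M →
            ∃[ m ] ∃[ n ] a ≡ m * + 3 × b ≡ n * + 3 × norm m n ≡ M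
3∣norm⇒3∣ a b M eq = y + x , y , a≡ , b≡ , ℤₚ.*-cancelˡ-≡ (+ 9) _ _ (begin
    + 9 * norm (y + x) y           ≡⟨ lemma₃ y x ⟩
    norm ((y + x) * + 3) (y * + 3) ≡⟨ cong₂ norm a≡ b≡ ⟨
    norm a b                       ≡⟨ eq ⟩
    + 9 * M                        ∎)
  where
  open ≡-Reasoning
  lemma₁ : ∀ a b M → norm a b ≡ + 9 * M → (a - b) * (a - b) ≡ (+ 3 * M - a * b) * + 3
  lemma₁ a b M eq = begin
    (a - b) * (a - b)            ≡⟨ p a b ⟩
    norm a b - + 3 * (a * b)     ≡⟨ cong (_- + 3 * (a * b)) eq ⟩
    + 9 * M - + 3 * (a * b)      ≡⟨ q a b M ⟩
    (+ 3 * M - a * b) * + 3      ∎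
    where
    p : ∀ a b → (a - b) * (a - b) ≡ a * a + a * b + b * b - + 3 * (a * b)
    p = solve-∀
    q : ∀ a b M → + 9 * M - + 3 * (a * b) ≡ (+ 3 * M - a * b) * + 3
    q = solve-∀
  3∣a-b = 3∣i²⇒3∣i (a - b) (+ 3 * M - a * b) (lemma₁ a b M eq)
  x = proj₁ 3∣a-b
  a≡b+3m : a ≡ b + x * + 3
  a≡b+3m = trans (p a b) (cong (λ i → b + i) (proj₂ 3∣a-b))
    where
    p : ∀ a b → a ≡ b + (a - b)
    p = solve-∀
  lemma₂ : ∀ b x M → norm (b + x * + 3) b ≡ + 9 * M → b * b ≡ (M - b * x - x * x) * + 3
  lemma₂ b x M eq = ℤₚ.*-cancelˡ-≡ (+ 3) _ _ (begin
    + 3 * (b * b)                                        ≡⟨ p b x ⟩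
    norm (b + x * + 3) b - + 9 * (b * x + x * x)         ≡⟨ cong (_- + 9 * (b * x + x * x)) eq ⟩
    + 9 * M - + 9 * (b * x + x * x)                      ≡⟨ q b x M ⟩
    + 3 * ((M - b * x - x * x) * + 3)                    ∎)
    where
    p : ∀ b x → + 3 * (b * b) ≡
      (b + x * + 3) * (b + x * + 3) + (b + x * + 3) * b + b * b - + 9 * (b * x + x * x)
    p = solve-∀
    q : ∀ b x M → + 9 * M - + 9 * (b * x + x * x) ≡ + 3 * ((M - b * x - x * x) * + 3)
    q = solve-∀
  3∣b = 3∣i²⇒3∣i b (M - b * x - x * x) (lemma₂ b x M (trans (cong (λ a → norm a b) (sym a≡b+3m)) eq))
  y = proj₁ 3∣b
  b≡ = proj₂ 3∣b
  a≡ : a ≡ (y + x) * + 3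
  a≡ = trans a≡b+3m (trans (cong (_+ x * + 3) b≡) (sym (ℤₚ.*-distribʳ-+ (+ 3) y x)))
  lemma₃ : ∀ y x → + 9 * ((y + x) * (y + x) + (y + x) * y + y * y) ≡
    (y + x) * + 3 * ((y + x) * + 3) + (y + x) * + 3 * (y * + 3) + y * + 3 * (y * + 3)
  lemma₃ = solve-∀

-- What remains of (a, b) after k divisions. The factor is a power of -3 and not of 3 because -3 is
-- 1 modulo 4: dividing by it keeps the residue of a modulo 4, so the sign survives the descent.
record Reduced (k c : ℕ) (a b : ℤ) : Set where
  field
    {a₀ b₀ t s} : ℤ
    a₀≡1+4t : a₀ ≡ + 1 + + 4 * t
    b₀≡1+2s : b₀ ≡ + 1 + + 2 * s
    norm≡   : norm a₀ b₀ ≡ + c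
    a≡      : a ≡ (- + 3) ^ k * a₀
    b≡      : b ≡ (- + 3) ^ k * b₀

scale : ∀ k {x y z} → x ≡ y * + 3 → - y ≡ (- + 3) ^ k * z → x ≡ (- + 3) ^ suc k * z
scale k {x} {y} {z} x≡ -y≡ = trans x≡ (trans (p y) (trans (cong (- + 3 *_) -y≡)
  (sym (ℤₚ.*-assoc (- + 3) ((- + 3) ^ k) z))))
  where
  p : ∀ y → y * + 3 ≡ - + 3 * (- y)
  p = solve-∀

-- Since -m = 3m - 4m, the quotient of a by -3 is congruent to a modulo 4.
1+4-step : ∀ {a m t} → a ≡ m * + 3 → a ≡ + 1 + + 4 * t → - m ≡ + 1 + + 4 * (t - m)
1+4-step {a} {m} {t} a≡3m a≡ = trans (p m) (trans (cong (_- + 4 * m) (trans (sym a≡3m) a≡)) (q t m))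
  where
  p : ∀ m → - m ≡ m * + 3 - + 4 * m
  p = solve-∀
  q : ∀ t m → + 1 + + 4 * t - + 4 * m ≡ + 1 + + 4 * (t - m)
  q = solve-∀

1+2-step : ∀ {b n s} → b ≡ n * + 3 → b ≡ + 1 + + 2 * s → - n ≡ + 1 + + 2 * (s - + 2 * n)
1+2-step {b} {n} {s} b≡3n b≡ = trans (p n) (trans (cong (_- + 4 * n) (trans (sym b≡3n) b≡)) (q s n))
  where
  p : ∀ n → - n ≡ n * + 3 - + 4 * n
  p = solve-∀
  q : ∀ s n → + 1 + + 2 * s - + 4 * n ≡ + 1 + + 2 * (s - + 2 * n)
  q = solve-∀

norm-neg : ∀ m n → norm (- m) (- n) ≡ norm m n
norm-neg = p
  where
  p : ∀ m n → (- m) * (- m) + (- m) * (- n) + (- n) * (- n) ≡ m * m + m * n + n * n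
  p = solve-∀

descent : ∀ k c {a b t s} → a ≡ + 1 + + 4 * t → b ≡ + 1 + + 2 * s → norm a b ≡ (+ 9) ^ k * + c →
          Reduced k c a b
descent zero c {a} {b} {t} {s} a≡ b≡ eq = record
  { a₀ = a ; b₀ = b ; t = t ; s = s ; a₀≡1+4t = a≡ ; b₀≡1+2s = b≡ ; norm≡ = trans eq (ℤₚ.*-identityˡ (+ c))
  ; a≡ = sym (ℤₚ.*-identityˡ a) ; b≡ = sym (ℤₚ.*-identityˡ b) }
descent (suc k) c {a} {b} {t} {s} a≡ b≡ eq =
  lift (3∣norm⇒3∣ a b ((+ 9) ^ k * + c) (trans eq (ℤₚ.*-assoc (+ 9) ((+ 9) ^ k) (+ c))))
  where
  lift : (∃[ m ] ∃[ n ] a ≡ m * + 3 × b ≡ n * + 3 × norm m n ≡ (+ 9) ^ k * + c) → Reduced (suc k) c a b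
  lift (m , n , a≡3m , b≡3n , eq′) = record
    { a₀ = R.a₀ ; b₀ = R.b₀ ; t = R.t ; s = R.s ; a₀≡1+4t = R.a₀≡1+4t ; b₀≡1+2s = R.b₀≡1+2s ; norm≡ = R.norm≡
    ; a≡ = scale k {a} {m} {R.a₀} a≡3m R.a≡ ; b≡ = scale k {b} {n} {R.b₀} b≡3n R.b≡ }
    where
    module R = Reduced (descent k c { - m} { - n} {t = t - m} {s = s - + 2 * n} (1+4-step {a} {m} {t} a≡3m a≡)
      (1+2-step {b} {n} {s} b≡3n b≡) (trans (norm-neg m n) eq′))

-- Four times the form is 3a² + (a + 2b)². With |a| at least 3 this would be at least 27, against 4c
-- ≤ 12.
norm≤3⇒∣a∣≤2 : ∀ a b c → c ≤ 3 → norm a b ≡ + c → ∣ a ∣ ≤ 2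
norm≤3⇒∣a∣≤2 a b c c≤3 eq = ℕₚ.≮⇒≥ λ 2<∣a∣ → ℕₚ.<⇒≱ {12} {27} (ℕₚ.m≤m+n 13 14) (begin
    27                                ≤⟨ ℕₚ.*-monoʳ-≤ 3 (ℕₚ.*-mono-≤ 2<∣a∣ 2<∣a∣) ⟩
    3 ℕ.* ∣a∣²                        ≤⟨ ℕₚ.m≤m+n (3 ℕ.* ∣a∣²) ∣a+2b∣² ⟩
    3 ℕ.* ∣a∣² ℕ.+ ∣a+2b∣²            ≡⟨ ℤₚ.+-injective 4c ⟩
    4 ℕ.* c                           ≤⟨ ℕₚ.*-monoʳ-≤ 4 c≤3 ⟩
    12                                ∎)
  where
  open ℕₚ.≤-Reasoning
  ∣a∣² = ∣ a ∣ ℕ.* ∣ a ∣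
  ∣a+2b∣² = ∣ a + + 2 * b ∣ ℕ.* ∣ a + + 2 * b ∣
  4c : + (3 ℕ.* ∣a∣² ℕ.+ ∣a+2b∣²) ≡ + (4 ℕ.* c)
  4c = trans (ℤₚ.pos-+ (3 ℕ.* ∣a∣²) ∣a+2b∣²)
    (trans (cong₂ _+_ (trans (ℤₚ.pos-* 3 ∣a∣²) (cong (+ 3 *_) (sym (i*i≡+∣i∣² a))))
                      (sym (i*i≡+∣i∣² (a + + 2 * b))))
    (trans (p a b) (trans (cong (+ 4 *_) eq) (sym (ℤₚ.pos-* 4 c)))))
    where
    p : ∀ a b → + 3 * (a * a) + (a + + 2 * b) * (a + + 2 * b) ≡ + 4 * (a * a + a * b + b * b)
    p = solve-∀

3+n≰2 : ∀ {n} → ¬ suc (suc (suc n)) ≤ 2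
3+n≰2 (s≤s (s≤s ()))

∣1+4t∣≤2⇒1 : ∀ t → ∣ + 1 + + 4 * t ∣ ≤ 2 → + 1 + + 4 * t ≡ + 1
∣1+4t∣≤2⇒1 (+ 0) _ = refl
∣1+4t∣≤2⇒1 (+ suc n) (s≤s (s≤s le)) = contradiction (ℕₚ.m+n≡0⇒n≡0 n (ℕₚ.n≤0⇒n≡0 le)) λ ()
∣1+4t∣≤2⇒1 -[1+ n ] le = ⊥-elim (3+n≰2 (subst (_≤ 2)
  (trans (cong ∣_∣ (p (+ n))) (trans (ℤₚ.∣-i∣≡∣i∣ (+ 3 + + 4 * + n))
    (cong (λ i → ∣ + 3 + i ∣) (sym (ℤₚ.pos-* 4 n))))) le))
  where
  p : ∀ i → + 1 + + 4 * (- (+ 1 + i)) ≡ - (+ 3 + + 4 * i)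
  p = solve-∀

∣1+2s∣≤2⇒±1 : ∀ s → ∣ + 1 + + 2 * s ∣ ≤ 2 → + 1 + + 2 * s ≡ + 1 ⊎ + 1 + + 2 * s ≡ - + 1
∣1+2s∣≤2⇒±1 (+ 0) _ = inj₁ refl
∣1+2s∣≤2⇒±1 (+ suc n) (s≤s (s≤s le)) = contradiction (ℕₚ.m+n≡0⇒n≡0 n (ℕₚ.n≤0⇒n≡0 le)) λ ()
∣1+2s∣≤2⇒±1 -[1+ 0 ] _ = inj₂ refl
∣1+2s∣≤2⇒±1 -[1+ suc n ] le = ⊥-elim (3+n≰2 (subst (_≤ 2)
  (trans (cong ∣_∣ (p (+ n))) (trans (ℤₚ.∣-i∣≡∣i∣ (+ 3 + + 2 * + n))
    (cong (λ i → ∣ + 3 + i ∣) (sym (ℤₚ.pos-* 2 n))))) le))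
  where
  p : ∀ i → + 1 + + 2 * (- (+ 2 + i)) ≡ - (+ 3 + + 2 * i)
  p = solve-∀

reduced⇒a₀≡1 : ∀ {k c a b} → c ≤ 3 → (r : Reduced k c a b) → Reduced.a₀ r ≡ + 1
reduced⇒a₀≡1 {c = c} c≤3 r = trans R.a₀≡1+4t
  (∣1+4t∣≤2⇒1 R.t (subst (λ i → ∣ i ∣ ≤ 2) R.a₀≡1+4t (norm≤3⇒∣a∣≤2 R.a₀ R.b₀ c c≤3 R.norm≡)))
  where module R = Reduced r

reduced⇒b₀≡±1 : ∀ {k c a b} → c ≤ 3 → (r : Reduced k c a b) → Reduced.b₀ r ≡ + 1 ⊎ Reduced.b₀ r ≡ - + 1
reduced⇒b₀≡±1 {c = c} c≤3 r = [ inj₁ ∘ trans R.b₀≡1+2s , inj₂ ∘ trans R.b₀≡1+2s ]′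
  (∣1+2s∣≤2⇒±1 R.s (subst (λ i → ∣ i ∣ ≤ 2) R.b₀≡1+2s
    (norm≤3⇒∣a∣≤2 R.b₀ R.a₀ c c≤3 (trans (norm-comm R.b₀ R.a₀) R.norm≡))))
  where
  module R = Reduced r
  norm-comm : ∀ a b → norm a b ≡ norm b a
  norm-comm = p
    where
    p : ∀ a b → a * a + a * b + b * b ≡ b * b + b * a + a * a
    p = solve-∀

-- At the bottom of the descent a₀ is 1 and b₀ is 1 or -1. The form is 1 at (1, -1) and 3 at (1, 1),
-- so its value settles b₀ here and in `norm-3*9^k`.
norm-9^k : ∀ k {a b t s} → a ≡ + 1 + + 4 * t → b ≡ + 1 + + 2 * s → norm a b ≡ (+ 9) ^ k * + 1 →
           a ≡ (- + 3) ^ k × b ≡ - (- + 3) ^ k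
norm-9^k k {a} {b} {t} {s} a≡ b≡ eq =
  trans R.a≡ (trans (cong ((- + 3) ^ k *_) a₀≡1) (ℤₚ.*-identityʳ _)) ,
  trans R.b≡ (trans (cong ((- + 3) ^ k *_) b₀≡-1) (p ((- + 3) ^ k)))
  where
  r = descent k 1 {a} {b} {t} {s} a≡ b≡ eq
  module R = Reduced r
  a₀≡1 = reduced⇒a₀≡1 (s≤s z≤n) r
  b₀≡-1 : R.b₀ ≡ - + 1
  b₀≡-1 with reduced⇒b₀≡±1 (s≤s z≤n) r
  ... | inj₁ b₀≡1  = contradiction (trans (sym R.norm≡) (cong₂ norm a₀≡1 b₀≡1)) λ ()
  ... | inj₂ b₀≡-1 = b₀≡-1
  p : ∀ x → x * - + 1 ≡ - x
  p = solve-∀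

norm-3*9^k : ∀ k {a b t s} → a ≡ + 1 + + 4 * t → b ≡ + 1 + + 2 * s → norm a b ≡ (+ 9) ^ k * + 3 →
             a ≡ (- + 3) ^ k × b ≡ (- + 3) ^ k
norm-3*9^k k {a} {b} {t} {s} a≡ b≡ eq =
  trans R.a≡ (trans (cong ((- + 3) ^ k *_) a₀≡1) (ℤₚ.*-identityʳ _)) ,
  trans R.b≡ (trans (cong ((- + 3) ^ k *_) b₀≡1) (ℤₚ.*-identityʳ _))
  where
  r = descent k 3 {a} {b} {t} {s} a≡ b≡ eq
  module R = Reduced r
  a₀≡1 = reduced⇒a₀≡1 ℕₚ.≤-refl r
  b₀≡1 : R.b₀ ≡ + 1
  b₀≡1 with reduced⇒b₀≡±1 ℕₚ.≤-refl r
  ... | inj₁ b₀≡1  = b₀≡1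
  ... | inj₂ b₀≡-1 = contradiction (trans (sym R.norm≡) (cong₂ norm a₀≡1 b₀≡-1)) λ ()

-- This fixes Q modulo 4, namely 1 for even e and 3 for odd e, and with it the residue of the
-- deviation N(1) - Q.
9^k≡1+8u : ∀ k → ∃[ u ] (+ 9) ^ k ≡ + 1 + + 8 * u
9^k≡1+8u zero    = + 0 , refl
9^k≡1+8u (suc k) with 9^k≡1+8u k
... | u , eq = + 1 + + 9 * u , trans (cong (+ 9 *_) eq) (p u)
  where
  p : ∀ u → + 9 * (+ 1 + + 8 * u) ≡ + 1 + + 8 * (+ 1 + + 9 * u)
  p = solve-∀

+3^2k≡9^k : ∀ k → + (3 ℕ.^ (k ℕ.* 2)) ≡ (+ 9) ^ k
+3^2k≡9^k zero    = refl
+3^2k≡9^k (suc k) = trans (cong +_ (sym (ℕₚ.*-assoc 3 3 (3 ℕ.^ (k ℕ.* 2)))))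
  (trans (ℤₚ.pos-* 9 (3 ℕ.^ (k ℕ.* 2))) (cong (+ 9 *_) (+3^2k≡9^k k)))

-- Every nonzero deviation of the point count from q + 1 is the left side up to sign and a factor 2;
-- the right side shows it as a sign times 3^(k+1), the square root of 3q or of q.
3*-3^k : ∀ k → + 3 * (- + 3) ^ k ≡ -1ℤ ^ k * + (3 ℕ.^ suc k)
3*-3^k zero    = refl
3*-3^k (suc k) = begin
  + 3 * (- + 3 * (- + 3) ^ k)                ≡⟨ p ((- + 3) ^ k) ⟩
  -1ℤ * + 3 * (+ 3 * (- + 3) ^ k)            ≡⟨ cong (-1ℤ * + 3 *_) (3*-3^k k) ⟩
  -1ℤ * + 3 * (-1ℤ ^ k * + (3 ℕ.^ suc k))    ≡⟨ q (-1ℤ ^ k) (+ (3 ℕ.^ suc k)) ⟩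
  -1ℤ * -1ℤ ^ k * (+ 3 * + (3 ℕ.^ suc k))    ≡⟨ cong (-1ℤ * -1ℤ ^ k *_) (ℤₚ.pos-* 3 (3 ℕ.^ suc k)) ⟨
  -1ℤ * -1ℤ ^ k * + (3 ℕ.^ suc (suc k))      ∎
  where
  open ≡-Reasoning
  p : ∀ x → + 3 * (- + 3 * x) ≡ - + 1 * + 3 * (+ 3 * x)
  p = solve-∀
  q : ∀ x y → - + 1 * + 3 * (x * y) ≡ - + 1 * x * (+ 3 * y)
  q = solve-∀

⌊√3^2k⌋ : ∀ k → ⌊√ 3 ℕ.^ (k ℕ.* 2) ⌋ ≡ 3 ℕ.^ k
⌊√3^2k⌋ k = trans (cong ⌊√_⌋ (3^2k-square k)) (⌊√m²⌋ (3 ℕ.^ k))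

-- From the norm equation to the point counts

module Distribution (N₀ N₁ N₂ e : ℕ)
    (∑N : N₀ ℕ.+ N₁ ℕ.+ N₂ ≡ 3 ℕ.^ suc e)
    (∑N² : N₀ ℕ.* N₀ ℕ.+ N₁ ℕ.* N₁ ℕ.+ N₂ ℕ.* N₂ ℕ.+ 3 ℕ.^ e ≡ 3 ℕ.^ suc e ℕ.* 3 ℕ.^ e ℕ.+ 3 ℕ.^ suc e)
    (N₁≡ : ∃[ k ] N₁ ≡ 2 ℕ.* suc (2 ℕ.* k)) (N₂≡ : ∃[ k ] N₂ ≡ 2 ℕ.* k) where

  Q n₀ n₁ n₂ k₁ k₂ : ℤ
  Q = + (3 ℕ.^ e)
  n₀ = + N₀
  n₁ = + N₁
  n₂ = + N₂
  k₁ = + proj₁ N₁≡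
  k₂ = + proj₁ N₂≡

  q≡3Q : + (3 ℕ.^ suc e) ≡ + 3 * Q
  q≡3Q = ℤₚ.pos-* 3 (3 ℕ.^ e)

  ∑n : n₀ + n₁ + n₂ ≡ + 3 * Q
  ∑n = begin
    n₀ + n₁ + n₂              ≡⟨ cong (_+ n₂) (ℤₚ.pos-+ N₀ N₁) ⟨
    + (N₀ ℕ.+ N₁) + n₂        ≡⟨ ℤₚ.pos-+ (N₀ ℕ.+ N₁) N₂ ⟨
    + (N₀ ℕ.+ N₁ ℕ.+ N₂)      ≡⟨ cong +_ ∑N ⟩
    + (3 ℕ.^ suc e)           ≡⟨ q≡3Q ⟩
    + 3 * Q                   ∎
    where open ≡-Reasoning

  ∑n² : n₀ * n₀ + n₁ * n₁ + n₂ * n₂ + Q ≡ + 3 * Q * Q + + 3 * Q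
  ∑n² = begin
    n₀ * n₀ + n₁ * n₁ + n₂ * n₂ + Q
      ≡⟨ cong (_+ Q) (cong₂ _+_ (cong₂ _+_ (ℤₚ.pos-* N₀ N₀) (ℤₚ.pos-* N₁ N₁)) (ℤₚ.pos-* N₂ N₂)) ⟨
    + (N₀ ℕ.* N₀ ℕ.+ N₁ ℕ.* N₁ ℕ.+ N₂ ℕ.* N₂ ℕ.+ 3 ℕ.^ e)
      ≡⟨ cong +_ ∑N² ⟩
    + (3 ℕ.^ suc e ℕ.* 3 ℕ.^ e ℕ.+ 3 ℕ.^ suc e)
      ≡⟨ ℤₚ.pos-+ (3 ℕ.^ suc e ℕ.* 3 ℕ.^ e) (3 ℕ.^ suc e) ⟩
    + (3 ℕ.^ suc e ℕ.* 3 ℕ.^ e) + + (3 ℕ.^ suc e)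
      ≡⟨ cong₂ _+_ (trans (ℤₚ.pos-* (3 ℕ.^ suc e) (3 ℕ.^ e)) (cong (_* Q) q≡3Q)) q≡3Q ⟩
    + 3 * Q * Q + + 3 * Q ∎
    where open ≡-Reasoning

  n₁≡ : n₁ ≡ + 2 + + 4 * k₁
  n₁≡ = trans (cong +_ (proj₂ N₁≡)) (trans (ℤₚ.pos-* 2 (suc (2 ℕ.* proj₁ N₁≡)))
    (trans (cong (λ i → + 2 * (+ 1 + i)) (ℤₚ.pos-* 2 (proj₁ N₁≡))) (p k₁)))
    where
    p : ∀ k → + 2 * (+ 1 + + 2 * k) ≡ + 2 + + 4 * k
    p = solve-∀

  n₂≡ : n₂ ≡ + 2 * k₂
  n₂≡ = trans (cong +_ (proj₂ N₂≡)) (ℤₚ.pos-* 2 (proj₁ N₂≡))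

  n₀≡ : n₀ ≡ + 3 * Q - n₁ - n₂
  n₀≡ = trans (p n₀ n₁ n₂) (cong (λ i → i - n₁ - n₂) ∑n)
    where
    p : ∀ a b c → a ≡ a + b + c - b - c
    p = solve-∀

  -- The deviations of n₀, n₁, n₂ from Q add up to 0, so their squares add up to twice the form in
  -- the last two. By `∑n` and `∑n²` that sum of squares is 2Q.
  norm-deviation : norm (n₁ - Q) (n₂ - Q) ≡ Q
  norm-deviation = ℤₚ.*-cancelˡ-≡ (+ 2) (norm (n₁ - Q) (n₂ - Q)) Q (begin
    + 2 * norm (n₁ - Q) (n₂ - Q)
      ≡⟨ p n₁ n₂ Q ⟩
    (+ 3 * Q - n₁ - n₂) * (+ 3 * Q - n₁ - n₂) + n₁ * n₁ + n₂ * n₂ + Q - Q - + 3 * Q * Q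
      ≡⟨ cong (λ i → i * i + n₁ * n₁ + n₂ * n₂ + Q - Q - + 3 * Q * Q) n₀≡ ⟨
    n₀ * n₀ + n₁ * n₁ + n₂ * n₂ + Q - Q - + 3 * Q * Q
      ≡⟨ cong (λ i → i - Q - + 3 * Q * Q) ∑n² ⟩
    + 3 * Q * Q + + 3 * Q - Q - + 3 * Q * Q
      ≡⟨ r Q ⟩
    + 2 * Q ∎)
    where
    open ≡-Reasoning
    p : ∀ a b q → + 2 * ((a - q) * (a - q) + (a - q) * (b - q) + (b - q) * (b - q)) ≡
      (+ 3 * q - a - b) * (+ 3 * q - a - b) + a * a + b * b + q - q - + 3 * q * q
    p = solve-∀
    r : ∀ q → + 3 * q * q + + 3 * q - q - + 3 * q * q ≡ + 2 * q
    r = solve-∀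

  x-Q≡y⇒x≡Q+y : ∀ {x y} → x - Q ≡ y → x ≡ Q + y
  x-Q≡y⇒x≡Q+y {x} eq = trans (p x Q) (cong (λ i → Q + i) eq)
    where
    p : ∀ x q → x ≡ q + (x - q)
    p = solve-∀

  -- Here d is odd. As Q is 1 modulo 4 and n₁ is 2 modulo 4, the deviation n₁ - Q is 1 modulo 4,
  -- which is the normalisation of the descent.
  n-even : ∀ k → e ≡ k ℕ.* 2 → n₀ ≡ Q × n₁ ≡ Q + (- + 3) ^ k × n₂ ≡ Q - (- + 3) ^ k
  n-even k refl =
    trans n₀≡ (trans (cong₂ (λ i j → + 3 * Q - i - j) n₁≡Q+ n₂≡Q-) (p Q ((- + 3) ^ k))) , n₁≡Q+ , n₂≡Q-
    where
    u = proj₁ (9^k≡1+8u k)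
    Q≡1+8u : Q ≡ + 1 + + 8 * u
    Q≡1+8u = trans (+3^2k≡9^k k) (proj₂ (9^k≡1+8u k))
    -- The witnesses are read off from 2 + 4k₁ - (1 + 8u) and 2k₂ - (1 + 8u).
    deviation = norm-9^k k {n₁ - Q} {n₂ - Q} {k₁ - + 2 * u} {k₂ - + 1 - + 4 * u}
      (trans (cong₂ _-_ n₁≡ Q≡1+8u) (p₁ k₁ u)) (trans (cong₂ _-_ n₂≡ Q≡1+8u) (p₂ k₂ u))
      (trans norm-deviation (trans (+3^2k≡9^k k) (sym (ℤₚ.*-identityʳ ((+ 9) ^ k)))))
      where
      p₁ : ∀ k u → + 2 + + 4 * k - (+ 1 + + 8 * u) ≡ + 1 + + 4 * (k - + 2 * u)
      p₁ = solve-∀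
      p₂ : ∀ k u → + 2 * k - (+ 1 + + 8 * u) ≡ + 1 + + 2 * (k - + 1 - + 4 * u)
      p₂ = solve-∀
    n₁≡Q+ = x-Q≡y⇒x≡Q+y {n₁} (proj₁ deviation)
    n₂≡Q- = x-Q≡y⇒x≡Q+y {n₂} (proj₂ deviation)
    p : ∀ q x → + 3 * q - (q + x) - (q - x) ≡ q
    p = solve-∀

  -- Here d is even and Q is 3 modulo 4, so n₁ - Q is -1 modulo 4. Both deviations are negated to
  -- reach the normalisation of the descent, and the result is negated back.
  n-odd : ∀ k → e ≡ suc (k ℕ.* 2) →
          n₀ ≡ Q + + 2 * (- + 3) ^ k × n₁ ≡ Q - (- + 3) ^ k × n₂ ≡ Q - (- + 3) ^ k
  n-odd k refl =
    trans n₀≡ (trans (cong₂ (λ i j → + 3 * Q - i - j) n₁≡Q- n₂≡Q-) (p Q ((- + 3) ^ k))) , n₁≡Q- , n₂≡Q-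
    where
    u = proj₁ (9^k≡1+8u k)
    Q≡3*9^k : Q ≡ + 3 * (+ 9) ^ k
    Q≡3*9^k = trans (ℤₚ.pos-* 3 (3 ℕ.^ (k ℕ.* 2))) (cong (+ 3 *_) (+3^2k≡9^k k))
    Q≡3+24u : Q ≡ + 3 * (+ 1 + + 8 * u)
    Q≡3+24u = trans Q≡3*9^k (cong (+ 3 *_) (proj₂ (9^k≡1+8u k)))
    deviation = norm-3*9^k k { - (n₁ - Q)} { - (n₂ - Q)} {+ 6 * u - k₁} {+ 1 + + 12 * u - k₂}
      (trans (cong₂ (λ i j → - (i - j)) n₁≡ Q≡3+24u) (p₁ k₁ u))
      (trans (cong₂ (λ i j → - (i - j)) n₂≡ Q≡3+24u) (p₂ k₂ u))
      (trans (norm-neg (n₁ - Q) (n₂ - Q)) (trans norm-deviation (trans Q≡3*9^k (ℤₚ.*-comm (+ 3) ((+ 9) ^ k)))))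
      where
      p₁ : ∀ k u → - (+ 2 + + 4 * k - + 3 * (+ 1 + + 8 * u)) ≡ + 1 + + 4 * (+ 6 * u - k)
      p₁ = solve-∀
      p₂ : ∀ k u → - (+ 2 * k - + 3 * (+ 1 + + 8 * u)) ≡ + 1 + + 2 * (+ 1 + + 12 * u - k)
      p₂ = solve-∀
    negate : ∀ {x y} → - x ≡ y → x ≡ - y
    negate {x} eq = trans (sym (ℤₚ.neg-involutive x)) (cong -_ eq)
    n₁≡Q- = x-Q≡y⇒x≡Q+y {n₁} (negate (proj₁ deviation))
    n₂≡Q- = x-Q≡y⇒x≡Q+y {n₂} (negate (proj₂ deviation))
    p : ∀ q x → + 3 * q - (q - x) - (q - x) ≡ q + + 2 * x
    p = solve-∀

  +suc[3N]≡ : ∀ N x → + N ≡ Q + x → + suc (3 ℕ.* N) ≡ + (3 ℕ.^ suc e) + + 1 + + 3 * x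
  +suc[3N]≡ N x N≡ = begin
    + suc (3 ℕ.* N)                        ≡⟨ ℤₚ.pos-+ 1 (3 ℕ.* N) ⟩
    + 1 + + (3 ℕ.* N)                      ≡⟨ cong (λ i → + 1 + i) (trans (ℤₚ.pos-* 3 N) (cong (+ 3 *_) N≡)) ⟩
    + 1 + + 3 * (Q + x)                    ≡⟨ p Q x ⟩
    + 3 * Q + + 1 + + 3 * x                ≡⟨ cong (λ i → i + + 1 + + 3 * x) q≡3Q ⟨
    + (3 ℕ.^ suc e) + + 1 + + 3 * x        ∎
    where
    open ≡-Reasoning
    p : ∀ q x → + 1 + + 3 * (q + x) ≡ + 3 * q + + 1 + + 3 * x
    p = solve-∀

  point-count-odd : 2 ∤ suc e → let q = 3 ℕ.^ suc e in
    + suc (3 ℕ.* N₀) ≡ + q + + 1 ×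
    + suc (3 ℕ.* N₁) ≡ + q + + 1 + -1ℤ ^ (e / 2) * + ⌊√ 3 ℕ.* q ⌋ ×
    + suc (3 ℕ.* N₂) ≡ + q + + 1 - -1ℤ ^ (e / 2) * + ⌊√ 3 ℕ.* q ⌋
  point-count-odd 2∤d =
    trans (+suc[3N]≡ N₀ (+ 0) (trans (proj₁ n≡) (sym (ℤₚ.+-identityʳ Q)))) (ℤₚ.+-identityʳ _) ,
    trans (+suc[3N]≡ N₁ ((- + 3) ^ k) (proj₁ (proj₂ n≡))) (cong (λ i → + q + + 1 + i) 3x≡) ,
    trans (+suc[3N]≡ N₂ (- (- + 3) ^ k) (proj₂ (proj₂ n≡))) (cong (λ i → + q + + 1 + i)
      (trans (sym (ℤₚ.neg-distribʳ-* (+ 3) ((- + 3) ^ k))) (cong -_ 3x≡)))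
    where
    q = 3 ℕ.^ suc e
    k = suc e / 2
    e≡2k : e ≡ k ℕ.* 2
    e≡2k = ℕₚ.suc-injective (trans (m≡m%n+[m/n]*n (suc e) 2) (cong (ℕ._+ k ℕ.* 2) (2∤⇒%2≡1 (suc e) 2∤d)))
    n≡ = n-even k e≡2k
    3x≡ : + 3 * (- + 3) ^ k ≡ -1ℤ ^ (e / 2) * + ⌊√ 3 ℕ.* q ⌋
    -- With e = 2k one has 3q = 9^(k+1), whose square root is 3^(k+1).
    3x≡ = trans (3*-3^k k) (cong₂ (λ i j → -1ℤ ^ i * + j)
      (sym (trans (cong (_/ 2) e≡2k) (m*n/n≡m k 2)))
      (sym (trans (cong (λ i → ⌊√ 3 ℕ.^ suc (suc i) ⌋) e≡2k) (⌊√3^2k⌋ (suc k)))))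

  point-count-even : 2 ∣ suc e → let q = 3 ℕ.^ suc e in
    + suc (3 ℕ.* N₀) ≡ + q + + 1 - -1ℤ ^ (suc e / 2) * (+ 2 * + ⌊√ q ⌋) ×
    + suc (3 ℕ.* N₁) ≡ + q + + 1 + -1ℤ ^ (suc e / 2) * + ⌊√ q ⌋ ×
    + suc (3 ℕ.* N₂) ≡ + q + + 1 + -1ℤ ^ (suc e / 2) * + ⌊√ q ⌋
  -- As d is positive, its half is some k + 1, and then e = 2k + 1 and q = 9^(k+1).
  point-count-even (divides (suc k) d≡) =
    trans (+suc[3N]≡ N₀ (+ 2 * (- + 3) ^ k) (proj₁ n≡)) (cong (λ i → + q + + 1 + i) (begin
      + 3 * (+ 2 * (- + 3) ^ k)                           ≡⟨ p₀ ((- + 3) ^ k) ⟩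
      - (+ 2 * - (+ 3 * (- + 3) ^ k))                     ≡⟨ cong (λ i → - (+ 2 * i)) -3x≡ ⟩
      - (+ 2 * (-1ℤ ^ (suc e / 2) * + ⌊√ q ⌋))            ≡⟨ p₁ (-1ℤ ^ (suc e / 2)) (+ ⌊√ q ⌋) ⟩
      - (-1ℤ ^ (suc e / 2) * (+ 2 * + ⌊√ q ⌋))            ∎)) ,
    trans (+suc[3N]≡ N₁ (- (- + 3) ^ k) (proj₁ (proj₂ n≡))) (cong (λ i → + q + + 1 + i) 3[-x]≡) ,
    trans (+suc[3N]≡ N₂ (- (- + 3) ^ k) (proj₂ (proj₂ n≡))) (cong (λ i → + q + + 1 + i) 3[-x]≡)
    where
    open ≡-Reasoning
    q = 3 ℕ.^ suc e
    n≡ = n-odd k (ℕₚ.suc-injective d≡)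
    -- The exponent d / 2 is k + 1, one more than the k in `3*-3^k`; the additional factor -1
    -- absorbs the minus sign.
    -3x≡ : - (+ 3 * (- + 3) ^ k) ≡ -1ℤ ^ (suc e / 2) * + ⌊√ q ⌋
    -3x≡ = begin
      - (+ 3 * (- + 3) ^ k)                   ≡⟨ cong -_ (3*-3^k k) ⟩
      - (-1ℤ ^ k * + (3 ℕ.^ suc k))           ≡⟨ p (-1ℤ ^ k) (+ (3 ℕ.^ suc k)) ⟩
      -1ℤ ^ suc k * + (3 ℕ.^ suc k)           ≡⟨ cong₂ (λ i j → -1ℤ ^ i * + j)
                                                   (trans (cong (_/ 2) d≡) (m*n/n≡m (suc k) 2))
                                                   (trans (cong (λ i → ⌊√ 3 ℕ.^ i ⌋) d≡) (⌊√3^2k⌋ (suc k))) ⟨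
      -1ℤ ^ (suc e / 2) * + ⌊√ q ⌋            ∎
      where
      p : ∀ x y → - (x * y) ≡ - + 1 * x * y
      p = solve-∀
    3[-x]≡ : + 3 * - (- + 3) ^ k ≡ -1ℤ ^ (suc e / 2) * + ⌊√ q ⌋
    3[-x]≡ = trans (sym (ℤₚ.neg-distribʳ-* (+ 3) ((- + 3) ^ k))) -3x≡
    p₀ : ∀ x → + 3 * (+ 2 * x) ≡ - (+ 2 * - (+ 3 * x))
    p₀ = solve-∀
    p₁ : ∀ x y → - (+ 2 * (x * y)) ≡ - (x * (+ 2 * y))
    p₁ = solve-∀

proposition3p2 :
  ∀ {c ℓ₁ ℓ₂} (F : HeytingField c ℓ₁ ℓ₂) (d : ℕ) → d ≥ 1 →
  let module F = HeytingField F
      q = 3 ℕ.^ d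
  in
  F.setoid HasCardinality q →
  (b : F.Carrier) →
  ∃[ #E ] (E F b HasCardinality #E) ×
    (2 ∤ d →
      (Tr F d b F.≈ F.0# →
        + #E ≡ + q + + 1) ×
      (Tr F d b F.≈ F.1# →
        + #E ≡ + q + + 1 + -1ℤ ^ ((d ∸ 1) / 2) * + ⌊√ 3 ℕ.* q ⌋) ×
      (Tr F d b F.≈ F.- F.1# →
        + #E ≡ + q + + 1 - -1ℤ ^ ((d ∸ 1) / 2) * + ⌊√ 3 ℕ.* q ⌋)) ×
    (2 ∣ d →
      (Tr F d b F.≈ F.0# →
        + #E ≡ + q + + 1 - -1ℤ ^ (d / 2) * (+ 2 * + ⌊√ q ⌋)) ×
      (Tr F d b F.≈ F.1# ⊎ Tr F d b F.≈ F.- F.1# →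
        + #E ≡ + q + + 1 + -1ℤ ^ (d / 2) * + ⌊√ q ⌋))
proposition3p2 F (suc e) _ F↔q b =
  -- The count depends on b only through its trace, so in each case `by` replaces T b by the
  -- constant to which it is equal.
  suc (3 ℕ.* N (T b)) , #E b ,
  (λ 2∤d → let odd₀ , odd₁ , odd₂ = point-count-odd 2∤d in
    (λ Tr≈0 → by Tr≈0 odd₀) , (λ Tr≈1 → by Tr≈1 odd₁) , (λ Tr≈-1 → by Tr≈-1 odd₂)) ,
  (λ 2∣d → let even₀ , even₁ , even₂ = point-count-even 2∣d in
    (λ Tr≈0 → by Tr≈0 even₀) , [ (λ Tr≈1 → by Tr≈1 even₁) , (λ Tr≈-1 → by Tr≈-1 even₂) ]′)
  where
  module F = HeytingField F
  open Field3^ F e F↔q using (N; T; N-cong; #E; ∑N≡q; ∑N²; N[1]≡2[2k+1]; N[-1]≡2k)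
  open Distribution (N F.0#) (N F.1#) (N (F.- F.1#)) e ∑N≡q ∑N² N[1]≡2[2k+1] N[-1]≡2k

  by : ∀ {c i} → T b F.≈ c → + suc (3 ℕ.* N c) ≡ i → + suc (3 ℕ.* N (T b)) ≡ i
  by T≈c = trans (cong (λ n → + suc (3 ℕ.* n)) (N-cong T≈c))
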